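{- The fragments $\Sigma_{2,0,1}^{\mathfrak{D}}$, $\Sigma_{1,0,1}^{\mathfrak{B}}$ and $\Sigma_{1,3,2}^{\mathfrak{F}}$ are undecidable. That is: there is no algorithm deciding whether a given $\Sigma$-sentence with 2 unbounded existential, 0 bounded existential and 1 bounded universal quantifiers is true in $\mathfrak{D}$; none deciding whether a given $\Sigma$-sentence with 1 unbounded existential, 0 bounded existential and 1 bounded universal quantifier is true in $\mathfrak{B}$; and none deciding whether a given $\Sigma$-sentence with 1 unbounded existential, 3 bounded existential and 2 bounded universal quantifiers is true in $\mathfrak{F}$.
   Context: Bit strings are elements of $\{\mathbf{0},\mathbf{1}\}^*$; $\varepsilon$ is the empty string, $|\alpha|$ the length. The language $\mathcal{L}_{BT}$ has constant symbols $e,0,1$, binary function symbol $\circ$, and binary relation symbol $\sqsubseteq$. The structures $\mathfrak{B},\mathfrak{D},\mathfrak{F}$ all have universe $\{\mathbf{0},\mathbf{1}\}^*$, interpret $e,0,1$ as $\varepsilon,\mathbf{0},\mathbf{1}$ and $\circ$ as concatenation; $\alpha\sqsubseteq\beta$ is interpreted in $\mathfrak{B}$ as "$\alpha$ is a substring of $\beta$", in $\mathfrak{D}$ as "$\alpha$ is a prefix of $\beta$", and in $\mathfrak{F}$ as $|\alpha|\le|\beta|$. $(\exists x\sqsubseteq t)\phi$ abbreviates $\exists x[x\sqsubseteq t\wedge\phi]$, $(\forall x\sqsubseteq t)\phi$ abbreviates $\forall x[x\sqsubseteq t\to\phi]$. $\Sigma$-formulas: $s\sqsubseteq t$, $\neg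 s\sqsubseteq t$, $s=t$, $\neg s=t$ (terms $s,t$) are $\Sigma$-formulas; they are closed under $\wedge,\vee$, and under $(\exists x\sqsubseteq t)$, $(\forall x\sqsubseteq t)$ and $\exists x$ where $x$ does not occur in $t$. A $\Sigma$-formula is a $\Sigma_{n,m,k}$-formula if it contains $n$ unbounded existential quantifiers, $m$ bounded existential quantifiers and $k$ bounded universal quantifiers; $\Sigma_{n,m,k}^{\mathfrak{A}}$ denotes the set of $\Sigma_{n,m,k}$-sentences true in $\mathfrak{A}$. -}

module Defs where

open import Data.Nat using (ℕ; zero; suc; _+_; _≤_; _≡ᵇ_)
open import Data.Bool using (Bool; true; false; if_then_else_)
open import Data.List using (List; []; _∷_; _++_; length)
open import Data.Maybe using (Maybe; just; nothing)
open import Data.Product using (Σ; ∃; _×_; _,_)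
open import Data.Sum using (_⊎_)
open import Data.Empty using (⊥)
open import Data.Unit using (⊤)
open import Relation.Nullary using (¬_)
open import Relation.Binary.PropositionalEquality using (_≡_)

data Bit : Set where
  𝟎 𝟏 : Bit

BitString : Set
BitString = List Bit

Var : Set
Var = ℕ

data Term : Set where
  e    : Term
  c0   : Term
  c1   : Term
  var  : Var → Term
  _∘ₜ_ : Term → Term → Term

data Formula : Set where
  _⊑ₜ_   : Term → Term → Formula
  ¬⊑     : Term → Term → Formula
  _≐_    : Term → Term → Formula
  ¬≐     : Term → Term → Formula
  _∧ₜ_   : Formula → Formula → Formula
  _∨ₜ_   : Formula → Formula → Formula
  ∃⊑     : Var → Term → Formula → Formula
  ∀⊑     : Var → Term → Formula → Formula
  ∃ᵤ     : Var → Formula → Formula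

varsT : Term → List Var
varsT e = []
varsT c0 = []
varsT c1 = []
varsT (var x) = x ∷ []
varsT (s ∘ₜ t) = varsT s ++ varsT t

data _∈ᵥ_ (x : Var) : List Var → Set where
  here  : ∀ {xs} → x ∈ᵥ (x ∷ xs)
  there : ∀ {y xs} → x ∈ᵥ xs → x ∈ᵥ (y ∷ xs)

remove : Var → List Var → List Var
remove x [] = []
remove x (y ∷ ys) = if x ≡ᵇ y then remove x ys else y ∷ remove x ys

fv : Formula → List Var
fv (s ⊑ₜ t) = varsT s ++ varsT t
fv (¬⊑ s t) = varsT s ++ varsT t
fv (s ≐ t) = varsT s ++ varsT t
fv (¬≐ s t) = varsT s ++ varsT t
fv (φ ∧ₜ ψ) = fv φ ++ fv ψ
fv (φ ∨ₜ ψ) = fv φ ++ fv ψ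
fv (∃⊑ x t φ) = varsT t ++ remove x (fv φ)
fv (∀⊑ x t φ) = varsT t ++ remove x (fv φ)
fv (∃ᵤ x φ) = remove x (fv φ)

WF : Formula → Set
WF (s ⊑ₜ t) = ⊤
WF (¬⊑ s t) = ⊤
WF (s ≐ t) = ⊤
WF (¬≐ s t) = ⊤
WF (φ ∧ₜ ψ) = WF φ × WF ψ
WF (φ ∨ₜ ψ) = WF φ × WF ψ
WF (∃⊑ x t φ) = ¬ (x ∈ᵥ varsT t) × WF φ
WF (∀⊑ x t φ) = ¬ (x ∈ᵥ varsT t) × WF φ
WF (∃ᵤ x φ) = WF φ

#∃ᵤ #∃⊑ #∀⊑ : Formula → ℕ
#∃ᵤ (φ ∧ₜ ψ) = #∃ᵤ φ + #∃ᵤ ψ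
#∃ᵤ (φ ∨ₜ ψ) = #∃ᵤ φ + #∃ᵤ ψ
#∃ᵤ (∃⊑ x t φ) = #∃ᵤ φ
#∃ᵤ (∀⊑ x t φ) = #∃ᵤ φ
#∃ᵤ (∃ᵤ x φ) = suc (#∃ᵤ φ)
#∃ᵤ _ = 0
#∃⊑ (φ ∧ₜ ψ) = #∃⊑ φ + #∃⊑ ψ
#∃⊑ (φ ∨ₜ ψ) = #∃⊑ φ + #∃⊑ ψ
#∃⊑ (∃⊑ x t φ) = suc (#∃⊑ φ)
#∃⊑ (∀⊑ x t φ) = #∃⊑ φ
#∃⊑ (∃ᵤ x φ) = #∃⊑ φ
#∃⊑ _ = 0
#∀⊑ (φ ∧ₜ ψ) = #∀⊑ φ + #∀⊑ ψ
#∀⊑ (φ ∨ₜ ψ) = #∀⊑ φ + #∀⊑ ψ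
#∀⊑ (∃⊑ x t φ) = #∀⊑ φ
#∀⊑ (∀⊑ x t φ) = suc (#∀⊑ φ)
#∀⊑ (∃ᵤ x φ) = #∀⊑ φ
#∀⊑ _ = 0

IsΣSentence : ℕ → ℕ → ℕ → Formula → Set
IsΣSentence n m k φ =
  WF φ × fv φ ≡ [] × #∃ᵤ φ ≡ n × #∃⊑ φ ≡ m × #∀⊑ φ ≡ k

-- Semantics: a structure is determined by its interpretation of ⊑

Rel : Set₁
Rel = BitString → BitString → Set

Env : Set
Env = Var → BitString

_[_↦_] : Env → Var → BitString → Env
(ρ [ x ↦ a ]) y = if x ≡ᵇ y then a else ρ y

⟦_⟧ₜ : Term → Env → BitString
⟦ e ⟧ₜ ρ = []
⟦ c0 ⟧ₜ ρ = 𝟎 ∷ []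
⟦ c1 ⟧ₜ ρ = 𝟏 ∷ []
⟦ var x ⟧ₜ ρ = ρ x
⟦ s ∘ₜ t ⟧ₜ ρ = ⟦ s ⟧ₜ ρ ++ ⟦ t ⟧ₜ ρ

Sat : Rel → Env → Formula → Set
Sat R ρ (s ⊑ₜ t) = R (⟦ s ⟧ₜ ρ) (⟦ t ⟧ₜ ρ)
Sat R ρ (¬⊑ s t) = ¬ R (⟦ s ⟧ₜ ρ) (⟦ t ⟧ₜ ρ)
Sat R ρ (s ≐ t) = ⟦ s ⟧ₜ ρ ≡ ⟦ t ⟧ₜ ρ
Sat R ρ (¬≐ s t) = ¬ (⟦ s ⟧ₜ ρ ≡ ⟦ t ⟧ₜ ρ)
Sat R ρ (φ ∧ₜ ψ) = Sat R ρ φ × Sat R ρ ψ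
Sat R ρ (φ ∨ₜ ψ) = Sat R ρ φ ⊎ Sat R ρ ψ
Sat R ρ (∃⊑ x t φ) = Σ BitString λ a → R a (⟦ t ⟧ₜ ρ) × Sat R (ρ [ x ↦ a ]) φ
Sat R ρ (∀⊑ x t φ) = (a : BitString) → R a (⟦ t ⟧ₜ ρ) → Sat R (ρ [ x ↦ a ]) φ
Sat R ρ (∃ᵤ x φ) = Σ BitString λ a → Sat R (ρ [ x ↦ a ]) φ

-- truth of a sentence (environment irrelevant for sentences)
TrueIn : Rel → Formula → Set
TrueIn R φ = Sat R (λ _ → []) φ

SubstringRel : Rel
SubstringRel α β = Σ BitString λ γ → Σ BitString λ δ → γ ++ α ++ δ ≡ β
PrefixRel : Rel
PrefixRel α β = Σ BitString λ γ → α ++ γ ≡ β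
LengthRel : Rel
LengthRel α β = length α ≤ length β

-- Gödel numbering of formulas (Cantor pairing)

tri : ℕ → ℕ
tri zero = zero
tri (suc n) = suc n + tri n

pair : ℕ → ℕ → ℕ
pair a b = tri (a + b) + b

⌜_⌝ₜ : Term → ℕ
⌜ e ⌝ₜ = pair 0 0
⌜ c0 ⌝ₜ = pair 1 0
⌜ c1 ⌝ₜ = pair 2 0
⌜ var x ⌝ₜ = pair 3 x
⌜ s ∘ₜ t ⌝ₜ = pair 4 (pair ⌜ s ⌝ₜ ⌜ t ⌝ₜ)

⌜_⌝ : Formula → ℕ
⌜ s ⊑ₜ t ⌝ = pair 0 (pair ⌜ s ⌝ₜ ⌜ t ⌝ₜ)
⌜ ¬⊑ s t ⌝ = pair 1 (pair ⌜ s ⌝ₜ ⌜ t ⌝ₜ)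
⌜ s ≐ t ⌝ = pair 2 (pair ⌜ s ⌝ₜ ⌜ t ⌝ₜ)
⌜ ¬≐ s t ⌝ = pair 3 (pair ⌜ s ⌝ₜ ⌜ t ⌝ₜ)
⌜ φ ∧ₜ ψ ⌝ = pair 4 (pair ⌜ φ ⌝ ⌜ ψ ⌝)
⌜ φ ∨ₜ ψ ⌝ = pair 5 (pair ⌜ φ ⌝ ⌜ ψ ⌝)
⌜ ∃⊑ x t φ ⌝ = pair 6 (pair x (pair ⌜ t ⌝ₜ ⌜ φ ⌝))
⌜ ∀⊑ x t φ ⌝ = pair 7 (pair x (pair ⌜ t ⌝ₜ ⌜ φ ⌝))
⌜ ∃ᵤ x φ ⌝ = pair 8 (pair x ⌜ φ ⌝)

data Instr : Set where
  inc : (r : ℕ) (next : ℕ) → Instr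
  dec : (r : ℕ) (next : ℕ) (ifZero : ℕ) → Instr

Program : Set
Program = List Instr

record Config : Set where
  constructor ⟨_,_⟩
  field
    pc   : ℕ
    regs : ℕ → ℕ
open Config public

nth : {A : Set} → List A → ℕ → Maybe A
nth [] n = nothing
nth (x ∷ xs) zero = just x
nth (x ∷ xs) (suc n) = nth xs n

setReg : (ℕ → ℕ) → ℕ → ℕ → (ℕ → ℕ)
setReg f r v s = if r ≡ᵇ s then v else f s

step : Program → Config → Config
step P c with nth P (pc c)
... | nothing = c
... | just (inc r j) = ⟨ j , setReg (regs c) r (suc (regs c r)) ⟩
... | just (dec r j k) with regs c r
...   | zero = ⟨ k , regs c ⟩
...   | suc v = ⟨ j , setReg (regs c) r v ⟩

run : Program → ℕ → Config → Config
run P zero c = c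
run P (suc n) c = run P n (step P c)

Halted : Program → Config → Set
Halted P c = nth P (pc c) ≡ nothing

init : ℕ → Config
init x = ⟨ 0 , (λ { zero → x ; (suc _) → 0 }) ⟩

RunsTo : Program → ℕ → ℕ → Set
RunsTo P x y = Σ ℕ λ t → Halted P (run P t (init x)) × regs (run P t (init x)) 0 ≡ y

DecidesFragment : Program → Rel → ℕ → ℕ → ℕ → Set
DecidesFragment P R n m k =
  (φ : Formula) → IsΣSentence n m k φ →
    (TrueIn R φ → RunsTo P ⌜ φ ⌝ 1) × (¬ TrueIn R φ → RunsTo P ⌜ φ ⌝ 0)

DecidableFragment : Rel → ℕ → ℕ → ℕ → Set
DecidableFragment R n m k = Σ Program λ P → DecidesFragment P R n m k

{-# OPTIONS --safe #-}
module Submission where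

-- Undecidability is obtained by diagonalisation, through a variant of Conway's
-- generalised Collatz problem. A configuration (q , r₀ , r₁ , …) of a counter
-- machine is coded by the number N · W + s, where N is the product of the powers
-- pᵢ ^ rᵢ for pairwise coprime pᵢ and the residue s identifies q. Every instruction
-- then acts by finitely many rules a · k + b ↦ c · k + d, and the strings
-- 1ᵃᵏ⁺ᵇ = uᵃ 1ᵇ with u = 1ᵏ are terms in the single variable u. A halting computation
-- M₀ , … , Mₜ is recorded by x = 0 1^M₀ 0 1^M₁ 0 … 0 1^Mₜ 0.
--   𝔅: some x contains 0 1^M₀ 0 and the blocks occurring in it are closed under the rules;
--   𝔇: some x begins with 0 1^M₀ 0, and each prefix u 0 of x is followed by blocks
--      M and M′ related by a rule, unless x ends there;
--   𝔉: the same, where bounded quantifiers express the splittings of x.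
-- If such a sentence is true, all configurations of the machine occur in x, so their
-- codes are bounded.
--
-- Given a decision program P, let D on input d assemble the number of the sentence
-- with matrix number d and M₀ = 2 ^ (d + 1), run P on it, halt on the answer 0 and
-- otherwise increment register 0 forever. For d the number of the matrix describing
-- D itself, truth of the sentence contradicts the unbounded growth, and its falsity
-- makes D halt, hence the sentence true. No program code occurs as an input: the
-- number of a matrix plays that role, and the start value is even while all
-- other codes are odd, so that it does not depend on W.

open import Defs
open import Data.Bool using (T; true; false)
open import Data.Empty using (⊥; ⊥-elim)
open import Data.Fin as Fin using (Fin; toℕ; #_)
open import Data.List using (List; []; _∷_; _++_; length; map; replicate; upTo)
open import Data.List.Membership.Propositional using (_∈_)
open import Data.List.Membership.Propositional.Properties using (∈-map⁺; ∈-map⁻; ∈-++⁺ˡ; ∈-++⁺ʳ; ∈-++⁻; ∈-upTo⁺; ∈-upTo⁻)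
open import Data.List.Properties using (length-replicate; length-map; length-++; length-++-≤ˡ; length-++-≤ʳ; ++-assoc; ++-cancelˡ; ∷-injectiveʳ; ≡-dec)
import Data.List.Relation.Binary.Infix.Heterogeneous as Infix
open import Data.List.Relation.Binary.Infix.Heterogeneous.Properties using (infix?)
open import Data.List.Relation.Binary.Pointwise using (Pointwise-≡⇒≡; ≡⇒Pointwise-≡)
open import Data.List.Relation.Unary.All using (All; []; _∷_)
open import Data.List.Relation.Unary.All.Properties using (++⁺)
open import Data.List.Relation.Unary.Any using (here; there)
open import Data.Maybe using (just; nothing)
open import Data.Nat
open import Data.Nat.Coprimality as Coprimality using (Coprime; coprime-divisor)
open import Data.Nat.DivMod using (_%_; _/_; m%n<n; m≡m%n+[m/n]*n)
open import Data.Nat.Divisibility using (_∣_; divides; ∣-trans; ∣m+n∣m⇒∣n; ∣1⇒≡1; m∣m*n; n∣m*n)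
open import Data.Nat.Properties
open import Data.Nat.Tactic.RingSolver using (solve-∀)
open import Data.Product using (∃; ∃₂; _×_; _,_; proj₁; proj₂)
open import Data.Sum using (_⊎_; inj₁; inj₂)
open import Data.Unit using (tt)
open import Data.Vec using (Vec; []; _∷_; lookup; _[_]≔_)
open import Relation.Binary.Definitions using (tri<; tri≈; tri>)
open import Relation.Binary.PropositionalEquality
open import Relation.Nullary using (¬_; Dec; yes; no)
open import Relation.Nullary.Decidable using (map′; True; toWitness)

-- Linear rewriting systems and histories

Lin : Set
Lin = ℕ × ℕ

infix 7 _at_
_at_ : Lin → ℕ → ℕ
(a , b) at k = k * a + b

-- The rule (ℓ , r) sends ℓ at k to r at k for every k, and the computation stops at the
-- values of halt.
record System : Set where
  field
    rules : List (Lin × Lin)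
    halt  : Lin
open System

-- The bounds k ≤ M are needed because some of the formulas only quantify over
-- strings no longer than the history.
record Step (S : System) (M M′ : ℕ) : Set where
  field
    enabled : ∃ λ ℓ → ∃ λ r → ∃ λ k →
              (ℓ , r) ∈ rules S × k ≤ M × M ≡ ℓ at k × M′ ≡ r at k
    determined : ∀ {ℓ r} k → (ℓ , r) ∈ rules S → M ≡ ℓ at k → M′ ≡ r at k
    live : ∀ k → M ≢ halt S at k
open Step

record Final (S : System) (M : ℕ) : Set where
  field
    halting : ∃ λ k → k ≤ M × M ≡ halt S at k
    stuck : ∀ {ℓ r} k → (ℓ , r) ∈ rules S → M ≢ ℓ at k
open Final

data Run (S : System) : List ℕ → Set where
  [] : Run S []
  [_] : ∀ {M} → Final S M → Run S (M ∷ [])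
  _∷_ : ∀ {M M′ Ms} → Step S M M′ → Run S (M′ ∷ Ms) → Run S (M ∷ M′ ∷ Ms)

-- Histories as bit strings

ones : ℕ → BitString
ones n = replicate n 𝟏

-- The zeros on both sides make the block of ones maximal; otherwise every smaller number would
-- occur as well.
Occurs : ℕ → BitString → Set
Occurs M x = SubstringRel (𝟎 ∷ ones M ++ 𝟎 ∷ []) x

blocks : List ℕ → BitString
blocks [] = []
blocks (M ∷ Ms) = ones M ++ 𝟎 ∷ blocks Ms

ones-+ : ∀ m n → ones m ++ ones n ≡ ones (m + n)
ones-+ zero n = refl
ones-+ (suc m) n = cong (𝟏 ∷_) (ones-+ m n)

ones-comm : ∀ k → ones k ++ 𝟏 ∷ [] ≡ 𝟏 ∷ ones k
ones-comm zero = refl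
ones-comm (suc k) = cong (𝟏 ∷_) (ones-comm k)

-- Comparing first letters shows that `u`, if nonempty, begins with 𝟏, and cancelling them leaves
-- the same equation for its tail. So 1* is definable by an equation without quantifiers.
comm⇒ones : ∀ u → u ++ 𝟏 ∷ [] ≡ 𝟏 ∷ u → ∃ λ k → u ≡ ones k
comm⇒ones [] _ = 0 , refl
comm⇒ones (𝟎 ∷ u) ()
comm⇒ones (𝟏 ∷ u) p with comm⇒ones u (∷-injectiveʳ p)
... | k , q = suc k , cong (𝟏 ∷_) q

ones-𝟎-injective : ∀ m n {x y} → ones m ++ 𝟎 ∷ x ≡ ones n ++ 𝟎 ∷ y → m ≡ n × x ≡ y
ones-𝟎-injective zero zero refl = refl , refl
ones-𝟎-injective (suc m) (suc n) p with ones-𝟎-injective m n (∷-injectiveʳ p)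
... | q , r = cong suc q , r

-- A run of ones contains no 𝟎, so the 𝟎 singled out on the left is either the separator after the
-- run or lies in `w`.
split-ones : ∀ u {v w} n → u ++ 𝟎 ∷ v ≡ ones n ++ 𝟎 ∷ w →
             v ≡ w ⊎ ∃ λ u′ → u′ ++ 𝟎 ∷ v ≡ w
split-ones [] n p = inj₁ (proj₂ (ones-𝟎-injective 0 n p))
split-ones (𝟎 ∷ u) zero p = inj₂ (u , ∷-injectiveʳ p)
split-ones (𝟏 ∷ u) (suc n) p = split-ones u n (∷-injectiveʳ p)

-- Every 𝟎 of a history is a separator, and a final segment of a run is a run. After the last
-- separator the empty run remains.
suffix-run : ∀ {S Ms} u {v} → Run S Ms → u ++ 𝟎 ∷ v ≡ 𝟎 ∷ blocks Ms →
             ∃ λ Ns → Run S Ns × v ≡ blocks Ns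
suffix-blocks : ∀ {S Ms} u {v} → Run S Ms → u ++ 𝟎 ∷ v ≡ blocks Ms →
                ∃ λ Ns → Run S Ns × v ≡ blocks Ns
suffix-run [] R p = _ , R , ∷-injectiveʳ p
suffix-run (_ ∷ u) R p = suffix-blocks u R (∷-injectiveʳ p)
suffix-blocks [] [] ()
suffix-blocks (_ ∷ _) [] ()
suffix-blocks u ([_] {M} _) p with split-ones u M p
... | inj₁ q = [] , [] , q
... | inj₂ (u′ , q) = suffix-blocks u′ [] q
suffix-blocks u (_∷_ {M} _ R) p with split-ones u M p
... | inj₁ q = _ , R , q
... | inj₂ (u′ , q) = suffix-blocks u′ R q

blocks-head : ∀ {v} M Ns → ones M ++ 𝟎 ∷ v ≡ blocks Ns →
              ∃ λ Ns′ → Ns ≡ M ∷ Ns′ × v ≡ blocks Ns′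
blocks-head zero [] ()
blocks-head (suc M) [] ()
blocks-head M (N ∷ Ns) p with ones-𝟎-injective M N p
... | refl , q = Ns , refl , q

length-ones : ∀ n → length (ones n) ≡ n
length-ones n = length-replicate n

-- The common consequence of the three sentences. Only `Step` is considered, so blocks of `x` that
-- code no configuration are harmless.
Closed : System → BitString → Set
Closed S x = ∀ {M M′} → Step S M M′ → Occurs M x → Occurs M′ x

assoc₂ : ∀ (u : BitString) m v → u ++ (𝟎 ∷ ones m ++ 𝟎 ∷ []) ++ v ≡ u ++ 𝟎 ∷ (ones m ++ 𝟎 ∷ v)
assoc₂ u m v = cong (λ z → u ++ 𝟎 ∷ z) (++-assoc (ones m) (𝟎 ∷ []) v)

occurs : ∀ u m v {x} → u ++ 𝟎 ∷ (ones m ++ 𝟎 ∷ v) ≡ x → Occurs m x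
occurs u m v p = u , v , trans (assoc₂ u m v) p

occurs-inv : ∀ {m x} → Occurs m x → ∃₂ λ u v → u ++ 𝟎 ∷ (ones m ++ 𝟎 ∷ v) ≡ x
occurs-inv {m} (u , v , p) = u , v , trans (sym (assoc₂ u m v)) p

-- With a rule, `z` is arbitrary: the second block is examined in turn when its own preceding
-- separator is considered.
Continues : System → ℕ → BitString → Set
Continues S k v =
  v ≡ ones (halt S at k) ++ 𝟎 ∷ [] ⊎
  ∃ λ ℓ → ∃ λ r → (ℓ , r) ∈ rules S × ∃ λ z →
    v ≡ ones (ℓ at k) ++ 𝟎 ∷ (ones (r at k) ++ 𝟎 ∷ z)

-- At a block `M` with a step, `live` rules out the halting alternative, and `determined` forces the
-- next block to be `M′`, whichever rule and parameter the string supplies.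
continues⇒closed : ∀ {S x} →
  (∀ u v → u ++ 𝟎 ∷ v ≡ x → v ≡ [] ⊎ ∃ λ k → Continues S k v) → Closed S x
continues⇒closed {S} h {M} {M′} st o with occurs-inv {M} o
... | u , v , p with h u _ p
... | inj₁ q = ⊥-elim (no-nil M q)
  where
  no-nil : ∀ n {v} → ones n ++ 𝟎 ∷ v ≡ [] → _
  no-nil zero ()
  no-nil (suc n) ()
... | inj₂ (k , inj₁ q) = ⊥-elim (live st k (proj₁ (ones-𝟎-injective M _ q)))
... | inj₂ (k , inj₂ (ℓ , r , i , z , q)) with ones-𝟎-injective M (ℓ at k) q
... | m , refl rewrite determined st k i m =
  occurs (u ++ 𝟎 ∷ ones M) (r at k) z
    (trans (++-assoc u (𝟎 ∷ ones M) _) p)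

ones≤ : ∀ n w → n ≤ length (ones n ++ w)
ones≤ zero w = z≤n
ones≤ (suc n) w = s≤s (ones≤ n w)

run-continues : ∀ {S Ms} → Run S Ms → ∀ u v → u ++ 𝟎 ∷ v ≡ 𝟎 ∷ blocks Ms →
  v ≡ [] ⊎ ∃ λ k → k ≤ length v × Continues S k v
run-continues R u v p with suffix-run u R p
... | [] , [] , q = inj₁ q
... | (M ∷ []) , [ f ] , refl with halting f
... | k , k≤ , refl = inj₂ (k , ≤-trans k≤ (ones≤ M (𝟎 ∷ [])) , inj₁ refl)
run-continues R u v p | (M ∷ M′ ∷ Ms) , (st ∷ _) , refl with enabled st
... | ℓ , r , k , i , k≤ , refl , refl =
  inj₂ (k , ≤-trans k≤ (ones≤ M _) , inj₂ (ℓ , r , i , blocks Ms , refl))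

-- A block of the history is an entry of the run. If it is the last one, `stuck` excludes the rule;
-- otherwise `determined` identifies the next entry.
run-closed : ∀ {S Ms ℓ r k} → Run S Ms → (ℓ , r) ∈ rules S →
  Occurs (ℓ at k) (𝟎 ∷ blocks Ms) → Occurs (r at k) (𝟎 ∷ blocks Ms)
run-closed {k = k} R i o with occurs-inv o
... | u , v , p with suffix-run u R p
... | Ns , R′ , q with blocks-head _ Ns q
run-closed {k = k} R i o | u , v , p | _ , [ f ] , q | _ , refl , _ =
  ⊥-elim (stuck f k i refl)
run-closed {ℓ = ℓ} {r} {k} R i o | u , v , p | _ , (_∷_ {Ms = Ms} st _) , q | _ , refl , refl
  rewrite determined st k i refl =
  occurs (u ++ 𝟎 ∷ ones (ℓ at k)) (r at k) (blocks Ms)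
    (trans (++-assoc u (𝟎 ∷ ones (ℓ at k)) _) p)

run-occurs : ∀ M Ms → Occurs M (𝟎 ∷ blocks (M ∷ Ms))
run-occurs M Ms = occurs [] M (blocks Ms) refl

occurs-≤ : ∀ {M x} → Occurs M x → M ≤ length x
occurs-≤ {M} o with occurs-inv {M} o
... | u , v , refl = begin
  M ≡⟨ length-ones M ⟨
  length (ones M) ≤⟨ m≤m+n _ _ ⟩
  length (ones M) + length (𝟎 ∷ v) ≡⟨ length-++ (ones M) ⟨
  length (ones M ++ 𝟎 ∷ v) ≤⟨ n≤1+n _ ⟩
  length (𝟎 ∷ ones M ++ 𝟎 ∷ v) ≤⟨ m≤n+m _ _ ⟩
  length u + length (𝟎 ∷ ones M ++ 𝟎 ∷ v) ≡⟨ length-++ u ⟨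
  length (u ++ 𝟎 ∷ ones M ++ 𝟎 ∷ v) ∎
  where open ≤-Reasoning

-- Counter machines as linear systems

-- Sylvester's sequence: each base is one more than the product of the preceding ones.
baseProduct : ℕ → ℕ
base : ℕ → ℕ
baseProduct zero = 1
baseProduct (suc n) = base n * baseProduct n
base n = suc (baseProduct n)

base∣baseProduct : ∀ {i j} → i < j → base i ∣ baseProduct j
base∣baseProduct {i} {suc j} i<sj with m≤n⇒m<n∨m≡n (≤-pred i<sj)
... | inj₁ i<j = ∣-trans (base∣baseProduct i<j) (n∣m*n (base j))
... | inj₂ refl = m∣m*n (baseProduct j)

-- A common divisor divides both `baseProduct j` and its successor.
base-coprime-< : ∀ {i j} → i < j → Coprime (base i) (base j)
base-coprime-< {i} {j} i<j {d} (p , q) =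
  ∣1⇒≡1 (∣m+n∣m⇒∣n (subst (d ∣_) (+-comm 1 (baseProduct j)) q) (∣-trans p (base∣baseProduct i<j)))

base-coprime : ∀ {i j} → i ≢ j → Coprime (base i) (base j)
base-coprime {i} {j} i≢j with <-cmp i j
... | tri< i<j _ _ = base-coprime-< i<j
... | tri≈ _ i≡j _ = ⊥-elim (i≢j i≡j)
... | tri> _ _ j<i = Coprimality.sym (base-coprime-< j<i)

baseProduct>0 : ∀ n → 0 < baseProduct n
baseProduct>0 zero = s≤s z≤n
baseProduct>0 (suc n) = *-mono-≤ {1} {base n} (s≤s z≤n) (baseProduct>0 n)

coprime-power : ∀ {p q} n {m} → Coprime p q → p ∣ q ^ n * m → p ∣ m
coprime-power zero {m} c h = subst (_ ∣_) (+-identityʳ m) h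
coprime-power {p} {q} (suc n) {m} c h =
  coprime-power n c (coprime-divisor c (subst (p ∣_) (*-assoc q (q ^ n) m) h))

godel : ℕ → (ℕ → ℕ) → ℕ
godel zero f = 1
godel (suc K) f = base K ^ f K * godel K f

-- Coprimality replaces unique factorisation: the powers of the other bases are cancelled one by one
-- until only 1 is left to divide.
base∤godel : ∀ K {f r} → f r ≡ 0 → ¬ base r ∣ godel K f
base∤godel zero {r = r} _ d with baseProduct r | baseProduct>0 r | ∣1⇒≡1 d
... | suc _ | _ | ()
base∤godel (suc K) {f} {r} z d with r ≟ K
... | yes refl rewrite z = base∤godel K z (subst (_ ∣_) (+-identityʳ _) d)
... | no r≢K = base∤godel K z (coprime-power (f K) (base-coprime r≢K) d)

setReg-≡ : ∀ f r v → setReg f r v r ≡ v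
setReg-≡ f r v with r ≡ᵇ r | ≡⇒≡ᵇ r r refl
... | true | _ = refl

setReg-≢ : ∀ f {r s} v → r ≢ s → setReg f r v s ≡ f s
setReg-≢ f {r} {s} v r≢s with r ≡ᵇ s in eq
... | false = refl
... | true = ⊥-elim (r≢s (≡ᵇ⇒≡ r s (subst T (sym eq) _)))

godel-cong : ∀ K {f g} → (∀ i → i < K → f i ≡ g i) → godel K f ≡ godel K g
godel-cong zero h = refl
godel-cong (suc K) h =
  cong₂ (λ a b → base K ^ a * b) (h K ≤-refl) (godel-cong K (λ i i<K → h i (m<n⇒m<1+n i<K)))

-- Serves both kinds of instruction: `g` is the new register content for `inc` and the old one for
-- `dec`.
godel-mul : ∀ K {f g r} → r < K → g r ≡ suc (f r) → (∀ i → r ≢ i → g i ≡ f i) →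
            godel K g ≡ base r * godel K f
godel-mul (suc K) {f} {g} {r} r<sK eq other with r ≟ K
... | yes refl rewrite eq | godel-cong K {g} {f} (λ i i<K → other i (λ r≡i → <⇒≢ i<K (sym r≡i))) =
  *-assoc (base r) (base r ^ f r) (godel r f)
... | no r≢K rewrite other K r≢K
    | godel-mul K {f} {g} (≤∧≢⇒< (≤-pred r<sK) r≢K) eq other = begin
  x * (base r * y) ≡⟨ *-assoc x (base r) y ⟨
  x * base r * y ≡⟨ cong (_* y) (*-comm x (base r)) ⟩
  base r * x * y ≡⟨ *-assoc (base r) x y ⟩
  base r * (x * y) ∎
  where
  open ≡-Reasoning
  x = base K ^ f K
  y = godel K f

godel-inc : ∀ K {r} f → r < K → godel K (setReg f r (suc (f r))) ≡ base r * godel K f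
godel-inc K {r} f r<K = godel-mul K r<K (setReg-≡ f r _) (λ i → setReg-≢ f _)

godel-dec : ∀ K {r} f v → r < K → f r ≡ suc v → godel K f ≡ base r * godel K (setReg f r v)
godel-dec K {r} f v r<K eq =
  godel-mul K r<K (trans eq (cong suc (sym (setReg-≡ f r v)))) (λ i r≢i → sym (setReg-≢ f v r≢i))

godel-single : ∀ K {f} → (∀ i → f (suc i) ≡ 0) → godel (suc K) f ≡ 2 ^ f 0
godel-single zero h = *-identityʳ _
godel-single (suc K) {f} h rewrite h K = trans (+-identityʳ _) (godel-single K {f} h)

n≤m^n : ∀ m n → 2 ≤ m → n ≤ m ^ n
n≤m^n m zero _ = z≤n
n≤m^n m (suc n) 2≤m = begin
  suc n ≤⟨ s≤s (n≤m^n m n 2≤m) ⟩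
  suc (m ^ n) ≤⟨ +-monoˡ-≤ (m ^ n) (m^n>0 m {{>-nonZero (≤-trans (s≤s z≤n) 2≤m)}} n) ⟩
  m ^ n + m ^ n ≡⟨ cong (m ^ n +_) (+-identityʳ (m ^ n)) ⟨
  2 * m ^ n ≤⟨ *-monoˡ-≤ (m ^ n) 2≤m ⟩
  m ^ suc n ∎
  where open ≤-Reasoning

godel>0 : ∀ K f → 0 < godel K f
godel>0 zero f = s≤s z≤n
godel>0 (suc K) f = *-mono-≤ (m^n>0 (base K) (f K)) (godel>0 K f)

godel-≥ : ∀ {K r} f → r < K → f r ≤ godel K f
godel-≥ {suc K} {r} f r<sK with r ≟ K
... | yes refl = ≤-trans (n≤m^n (base r) (f r) (s≤s (baseProduct>0 r)))
                         (m≤m*n _ _ {{>-nonZero (godel>0 r f)}})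
... | no r≢K = ≤-trans (godel-≥ f (≤∧≢⇒< (≤-pred r<sK) r≢K))
                       (m≤n*m _ _ {{>-nonZero (m^n>0 (base K) (f K))}})

reg : Instr → ℕ
reg (inc r _) = r
reg (dec r _ _) = r

-- A sum is a convenient bound for all register indices. The initial 1 covers register 0, which
-- holds the input even if no instruction mentions it.
registers : Program → ℕ
registers [] = 1
registers (i ∷ is) = suc (reg i) + registers is

registers>0 : ∀ P → 0 < registers P
registers>0 [] = s≤s z≤n
registers>0 (_ ∷ _) = s≤s z≤n

reg<registers : ∀ P q {i} → nth P q ≡ just i → reg i < registers P
reg<registers (i ∷ is) zero refl = m≤m+n (suc (reg i)) (registers is)
reg<registers (i ∷ is) (suc q) h = ≤-trans (reg<registers is q h) (m≤n+m _ (suc (reg i)))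

nth-just⇒< : ∀ {A : Set} (xs : List A) q {x} → nth xs q ≡ just x → q < length xs
nth-just⇒< (_ ∷ _) zero _ = s≤s z≤n
nth-just⇒< (_ ∷ xs) (suc q) h = s≤s (nth-just⇒< xs q h)

nth-nothing⇒≥ : ∀ {A : Set} (xs : List A) q → nth xs q ≡ nothing → length xs ≤ q
nth-nothing⇒≥ [] q _ = z≤n
nth-nothing⇒≥ (_ ∷ xs) (suc q) h = s≤s (nth-nothing⇒≥ xs q h)

step-halted : ∀ P c → Halted P c → step P c ≡ c
step-halted P c h with nth P (pc c)
step-halted P c refl | nothing = refl

step-inc : ∀ {P q r j} f → nth P q ≡ just (inc r j) →
           step P ⟨ q , f ⟩ ≡ ⟨ j , setReg f r (suc (f r)) ⟩
step-inc {P} {q} f h with nth P q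
step-inc f refl | just _ = refl

step-zero : ∀ {P q r j k} f → nth P q ≡ just (dec r j k) → f r ≡ 0 →
            step P ⟨ q , f ⟩ ≡ ⟨ k , f ⟩
step-zero {P} {q} {r} f h z with nth P q
step-zero {r = r} f refl z | just _ with f r
step-zero f refl refl | just _ | zero = refl

step-suc : ∀ {P q r j k v} f → nth P q ≡ just (dec r j k) → f r ≡ suc v →
           step P ⟨ q , f ⟩ ≡ ⟨ j , setReg f r v ⟩
step-suc {P} {q} {r} f h z with nth P q
step-suc {r = r} f refl z | just _ with f r
step-suc f refl refl | just _ | suc _ = refl

Move : Set
Move = Lin × Lin × ℕ

-- Register r is zero exactly when the Gödel number is not a multiple of base r,
-- that is, when it is in one of the residue classes 1 , … , base r - 1.
moves : Instr → List Move
moves (inc r j) = ((1 , 0) , (base r , 0) , j) ∷ []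
moves (dec r j k) = ((base r , 0) , (1 , 0) , j) ∷
  map (λ i → (base r , suc i) , (base r , suc i) , k) (upTo (baseProduct r))

-- Uniqueness of quotient and remainder: with `W = base r` it separates the residue classes of
-- `moves`, with `W = width` it recovers register code and label.
linear-unique : ∀ {W} x y {s t} → s < W → t < W → x * W + s ≡ y * W + t → x ≡ y × s ≡ t
linear-unique zero zero _ _ h = refl , h
linear-unique {W} zero (suc y) {s} {t} s< _ h =
  ⊥-elim (<⇒≱ s< (subst (W ≤_) (sym h) (≤-trans (m≤m+n W (y * W)) (m≤m+n _ t))))
linear-unique {W} (suc x) zero {s} {t} _ t< h =
  ⊥-elim (<⇒≱ t< (subst (W ≤_) h (≤-trans (m≤m+n W (x * W)) (m≤m+n _ s))))
linear-unique {W} (suc x) (suc y) {s} {t} s< t< h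
  with linear-unique x y s< t< (+-cancelˡ-≡ W _ _
         (trans (sym (+-assoc W (x * W) s)) (trans h (+-assoc W (y * W) t))))
... | p , q = cong suc p , q

at-one : ∀ k → (1 , 0) at k ≡ k
at-one k = trans (+-identityʳ (k * 1)) (*-identityʳ k)

module _ (P : Program) where

  code : (ℕ → ℕ) → ℕ
  code = godel (registers P)

  moves-complete : ∀ q f {i} → nth P q ≡ just i → ∃ λ ℓ → ∃ λ r → ∃ λ k →
    (ℓ , r , pc (step P ⟨ q , f ⟩)) ∈ moves i × k ≤ code f × code f ≡ ℓ at k ×
    code (regs (step P ⟨ q , f ⟩)) ≡ r at k
  moves-complete q f {inc r j} h rewrite step-inc {P} {q} f h =
    _ , _ , code f , here refl , ≤-refl , sym (at-one _) ,
    trans (godel-inc (registers P) f (reg<registers P q h))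
      (trans (*-comm (base r) (code f)) (sym (+-identityʳ _)))
  moves-complete q f {dec r j k} h with f r in eq
  ... | suc v rewrite step-suc {P} {q} f h eq =
    _ , _ , code (setReg f r v) , here refl , ≤mul , e₁ , sym (at-one _)
    where
    e₀ : code f ≡ base r * code (setReg f r v)
    e₀ = godel-dec (registers P) f v (reg<registers P q h) eq
    e₁ : code f ≡ (base r , 0) at code (setReg f r v)
    e₁ = trans e₀ (trans (*-comm (base r) _) (sym (+-identityʳ _)))
    ≤mul : code (setReg f r v) ≤ code f
    ≤mul = subst (code (setReg f r v) ≤_) (sym e₀) (m≤n*m _ (base r))
  ... | zero rewrite step-zero {P} {q} f h eq
    with code f % base r in at≡ | m%n<n (code f) (base r) | m≡m%n+[m/n]*n (code f) (base r)
  -- Remainder 0 would make `base r` divide the code although register `r` is zero.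
  ... | zero | _ | d = ⊥-elim (base∤godel (registers P) eq (divides (code f / base r) d))
  ... | suc i | s≤s i< | d =
    _ , _ , code f / base r , there (∈-map⁺ _ (∈-upTo⁺ i<)) ,
    subst (code f / base r ≤_) (sym d′) (≤-trans (m≤m*n _ (base r)) (m≤m+n _ (suc i))) , d′ , d′
    where
    d′ : code f ≡ (base r , suc i) at (code f / base r)
    d′ = trans d (+-comm (suc i) _)

  -- No pattern of the wrong kind can match: a zero register excludes the multiples of `base r`, a
  -- positive one excludes the nonzero residues.
  moves-sound : ∀ q f {i ℓ r j} k → nth P q ≡ just i → (ℓ , r , j) ∈ moves i →
    code f ≡ ℓ at k → code (regs (step P ⟨ q , f ⟩)) ≡ r at k × pc (step P ⟨ q , f ⟩) ≡ j
  moves-sound q f {inc r j} k h (here refl) at≡ rewrite step-inc {P} {q} f h =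
    trans (godel-inc (registers P) f (reg<registers P q h))
      (trans (*-comm (base r) (code f))
        (trans (cong (_* base r) (trans at≡ (at-one k))) (sym (+-identityʳ _)))) , refl
  moves-sound q f {dec r j′ k′} k h i∈ at≡ with f r in eq
  moves-sound q f {dec r j′ k′} k h (here refl) at≡ | zero =
    ⊥-elim (base∤godel (registers P) eq (divides k (trans at≡ (+-identityʳ _))))
  moves-sound q f {dec r j′ k′} k h (here refl) at≡ | suc v rewrite step-suc {P} {q} f h eq =
    trans (*-cancelˡ-≡ _ k (base r)
      (trans (sym (godel-dec (registers P) f v (reg<registers P q h) eq))
        (trans at≡ (trans (+-identityʳ _) (*-comm k (base r)))))) (sym (at-one k)) , refl
  moves-sound q f {dec r j′ k′} k h (there i∈) at≡ | zero with ∈-map⁻ _ i∈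
  ... | i , _ , refl rewrite step-zero {P} {q} f h eq = at≡ , refl
  moves-sound q f {dec r j′ k′} k h (there i∈) at≡ | suc v with ∈-map⁻ _ i∈
  ... | i , i∈′ , refl = ⊥-elim (0≢1+n (proj₂ (linear-unique {base r} (code (setReg f r v)) k
          (s≤s z≤n) (s≤s (∈-upTo⁻ i∈′)) (trans (sym e₁) at≡))))
    where
    e₁ : code f ≡ (base r , 0) at code (setReg f r v)
    e₁ = trans (godel-dec (registers P) f v (reg<registers P q h) eq)
               (trans (*-comm (base r) _) (sym (+-identityʳ _)))

  width : ℕ
  width = 2 * suc (length P)

  -- Truncation merges all halting program counters into the single value `length P`, so that one
  -- linear form describes halting.
  label : ℕ → ℕ
  label q = suc (2 * (q ⊓ length P))

  -- The coefficients of (k a + b) · `width` + `label q` as a linear form in k.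
  tag : ℕ → Lin → Lin
  tag q (a , b) = a * width , b * width + label q

  encode : Config → ℕ
  encode c = code (regs c) * width + label (pc c)

  label< : ∀ q → label q < width
  label< q = begin
    2 + 2 * (q ⊓ length P) ≤⟨ +-monoʳ-≤ 2 (*-monoʳ-≤ 2 (m⊓n≤n q (length P))) ⟩
    2 + 2 * length P ≡⟨ *-suc 2 (length P) ⟨
    width ∎
    where open ≤-Reasoning

  label-injective : ∀ q q′ → label q ≡ label q′ → q ⊓ length P ≡ q′ ⊓ length P
  label-injective q q′ h = *-cancelˡ-≡ _ _ 2 (suc-injective h)

  tag-at : ∀ q ℓ k → tag q ℓ at k ≡ (ℓ at k) * width + label q
  tag-at q (a , b) k = begin
    k * (a * width) + (b * width + label q) ≡⟨ cong (_+ (b * width + label q)) (*-assoc k a width) ⟨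
    k * a * width + (b * width + label q)   ≡⟨ +-assoc (k * a * width) (b * width) (label q) ⟨
    k * a * width + b * width + label q     ≡⟨ cong (_+ label q) (*-distribʳ-+ width (k * a) b) ⟨
    (k * a + b) * width + label q           ∎
    where open ≡-Reasoning

  instrRules : ℕ → Program → List (Lin × Lin)
  instrRules q [] = []
  instrRules q (i ∷ is) =
    map (λ (ℓ , r , j) → tag q ℓ , tag j r) (moves i) ++ instrRules (suc q) is

  -- Labels are odd and width is even, so the rule for the even starting value
  -- 2 k never interferes with the others.
  system : System
  system = record { rules = ((2 , 0) , tag 0 (1 , 0)) ∷ instrRules 0 P ; halt = tag (length P) (1 , 0) }

  ∈-instrRules⁺ : ∀ q₀ is q {i ℓ r j} → nth is q ≡ just i → (ℓ , r , j) ∈ moves i →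
                  (tag (q₀ + q) ℓ , tag j r) ∈ instrRules q₀ is
  ∈-instrRules⁺ q₀ (i ∷ is) zero refl m rewrite +-identityʳ q₀ = ∈-++⁺ˡ (∈-map⁺ _ m)
  ∈-instrRules⁺ q₀ (i ∷ is) (suc q) h m rewrite +-suc q₀ q =
    ∈-++⁺ʳ (map _ (moves i)) (∈-instrRules⁺ (suc q₀) is q h m)

  ∈-instrRules⁻ : ∀ q₀ is {ℓ r} → (ℓ , r) ∈ instrRules q₀ is →
    ∃ λ q → ∃ λ i → ∃ λ ℓ′ → ∃ λ r′ → ∃ λ j → nth is q ≡ just i × (ℓ′ , r′ , j) ∈ moves i ×
    ℓ ≡ tag (q₀ + q) ℓ′ × r ≡ tag j r′
  ∈-instrRules⁻ q₀ (i ∷ is) m with ∈-++⁻ (map _ (moves i)) m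
  ... | inj₁ m′ with ∈-map⁻ _ m′
  ... | (ℓ′ , r′ , j) , m″ , refl =
    0 , i , ℓ′ , r′ , j , refl , m″ , cong (λ z → tag z ℓ′) (sym (+-identityʳ q₀)) , refl
  ∈-instrRules⁻ q₀ (i ∷ is) m | inj₂ m′ with ∈-instrRules⁻ (suc q₀) is m′
  ... | q , i′ , ℓ′ , r′ , j , h , m″ , e₁ , e₂ =
    suc q , i′ , ℓ′ , r′ , j , h , m″ , trans e₁ (cong (λ z → tag z ℓ′) (sym (+-suc q₀ q))) , e₂

  labelled-odd : ∀ x q k → x * width + label q ≢ k * 2
  labelled-odd x q k h = even≢odd k (x * suc (length P) + y)
    (sym (trans (sym odd) (trans h (*-comm k 2))))
    where
    y = q ⊓ length P
    odd : x * width + label q ≡ suc (2 * (x * suc (length P) + y))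
    odd = begin
      x * (2 * suc (length P)) + suc (2 * y) ≡⟨ +-suc _ _ ⟩
      suc (x * (2 * suc (length P)) + 2 * y)
        ≡⟨ cong (λ z → suc (z + 2 * y)) (trans (sym (*-assoc x 2 _))
             (trans (cong (_* suc (length P)) (*-comm x 2)) (*-assoc 2 x _))) ⟩
      suc (2 * (x * suc (length P)) + 2 * y) ≡⟨ cong suc (*-distribˡ-+ 2 (x * suc (length P)) y) ⟨
      suc (2 * (x * suc (length P) + y)) ∎
      where open ≡-Reasoning

  encode-odd : ∀ c k → encode c ≢ (2 , 0) at k
  encode-odd c k h = labelled-odd (code (regs c)) (pc c) k (trans h (+-identityʳ (k * 2)))

  tag-odd : ∀ q ℓ k m → m * 2 ≢ tag q ℓ at k
  tag-odd q ℓ k m h = labelled-odd (ℓ at k) q m (trans (sym (tag-at q ℓ k)) (sym h))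

  encode-tag : ∀ c q ℓ k → encode c ≡ tag q ℓ at k →
               code (regs c) ≡ ℓ at k × pc c ⊓ length P ≡ q ⊓ length P
  encode-tag c q ℓ k h with linear-unique (code (regs c)) (ℓ at k) (label< (pc c)) (label< q)
                              (trans h (tag-at q ℓ k))
  ... | h₁ , h₂ = h₁ , label-injective (pc c) q h₂

  encode-at : ∀ c q ℓ k → code (regs c) ≡ ℓ at k → pc c ⊓ length P ≡ q ⊓ length P →
              encode c ≡ tag q ℓ at k
  encode-at c q ℓ k h₁ h₂ =
    trans (cong₂ (λ a b → a * width + suc (2 * b)) h₁ h₂) (sym (tag-at q ℓ k))

  encode-live : ∀ c {i} → nth P (pc c) ≡ just i → ∀ k → encode c ≢ halt system at k
  encode-live c h k e≡ with encode-tag c (length P) (1 , 0) k e≡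
  ... | _ , h₂ = <⇒≢ (nth-just⇒< P (pc c) h)
    (trans (sym (m≤n⇒m⊓n≡m (<⇒≤ (nth-just⇒< P (pc c) h)))) (trans h₂ (m≤n⇒m⊓n≡m ≤-refl)))

  encode-step : ∀ c {i} → nth P (pc c) ≡ just i → Step system (encode c) (encode (step P c))
  encode-step c@(⟨ q , f ⟩) {i} h = record { enabled = en ; determined = det ; live = encode-live c h }
    where
    q<L : q < length P
    q<L = nth-just⇒< P q h
    en : ∃ λ ℓ → ∃ λ r → ∃ λ k → (ℓ , r) ∈ rules system × k ≤ encode c ×
         encode c ≡ ℓ at k × encode (step P c) ≡ r at k
    en with moves-complete q f h
    ... | ℓ , r , k , m , k≤ , e₁ , e₂ =
      tag q ℓ , tag (pc (step P c)) r , k , there (∈-instrRules⁺ 0 P q h m) ,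
      ≤-trans k≤ (≤-trans (m≤m*n (code f) width) (m≤m+n _ (label q))) ,
      encode-at c q ℓ k e₁ refl , encode-at (step P c) (pc (step P c)) r k e₂ refl
    det : ∀ {ℓ r} k → (ℓ , r) ∈ rules system → encode c ≡ ℓ at k → encode (step P c) ≡ r at k
    det k (here refl) e≡ = ⊥-elim (encode-odd c k e≡)
    det k (there m) e≡ with ∈-instrRules⁻ 0 P m
    ... | q′ , i′ , ℓ′ , r′ , j , h′ , m′ , refl , refl
      with encode-tag c q′ ℓ′ k e≡
    -- Both counters address instructions, so truncation changes neither of them and they coincide.
    ... | e₁ , e₂ with trans (sym (m≤n⇒m⊓n≡m (<⇒≤ q<L)))
                        (trans e₂ (m≤n⇒m⊓n≡m (<⇒≤ (nth-just⇒< P q′ h′))))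
    ... | refl with moves-sound q f k h′ m′ e₁
    ... | e₃ , refl = encode-at (step P c) j r′ k e₃ refl

  encode-final : ∀ c → Halted P c → Final system (encode c)
  encode-final c h = record
    { halting = code (regs c) , ≤-trans (m≤m*n _ width) (m≤m+n _ (label (pc c))) ,
        encode-at c (length P) (1 , 0) (code (regs c)) (sym (at-one _))
          (trans L≡ (sym (m≤n⇒m⊓n≡m ≤-refl)))
    ; stuck = stuck′ }
    where
    L≡ : pc c ⊓ length P ≡ length P
    L≡ = m≥n⇒m⊓n≡n (nth-nothing⇒≥ P (pc c) h)
    stuck′ : ∀ {ℓ r} k → (ℓ , r) ∈ rules system → encode c ≢ ℓ at k
    stuck′ k (here refl) e≡ = encode-odd c k e≡
    stuck′ k (there m) e≡ with ∈-instrRules⁻ 0 P m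
    ... | q′ , _ , ℓ′ , _ , _ , h′ , _ , refl , refl with encode-tag c q′ ℓ′ k e≡
    ... | _ , e₂ = <⇒≢ (nth-just⇒< P q′ h′)
      (trans (sym (m≤n⇒m⊓n≡m (<⇒≤ (nth-just⇒< P q′ h′)))) (trans (sym e₂) L≡))

  -- Since `base 0` is 2, the register code of `init m` is `2 ^ m`. The start value is its double,
  -- and the first rule applies with k = `2 ^ m`.
  start-step : ∀ m → Step system (2 ^ m * 2) (encode (init m))
  start-step m = record
    { enabled = _ , _ , 2 ^ m , here refl , m≤m*n (2 ^ m) 2 , sym (+-identityʳ _) , target (2 ^ m) refl
    ; determined = det
    ; live = λ k → tag-odd (length P) (1 , 0) k (2 ^ m) }
    where
    target : ∀ k → k ≡ 2 ^ m → encode (init m) ≡ tag 0 (1 , 0) at k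
    target k refl = encode-at (init m) 0 (1 , 0) k (trans code-init (sym (at-one k))) refl
      where
      code-init : code (regs (init m)) ≡ 2 ^ m
      code-init with registers P | registers>0 P
      ... | suc K | _ = godel-single K {regs (init m)} (λ _ → refl)
    det : ∀ {ℓ r} k → (ℓ , r) ∈ rules system → 2 ^ m * 2 ≡ ℓ at k → encode (init m) ≡ r at k
    det k (here refl) e≡ = target k (*-cancelʳ-≡ k _ 2 (trans (sym (+-identityʳ _)) (sym e≡)))
    det k (there i) e≡ with ∈-instrRules⁻ 0 P i
    ... | q , _ , ℓ , _ , _ , _ , _ , refl , refl = ⊥-elim (tag-odd q ℓ k (2 ^ m) e≡)

  encode-≥ : ∀ c → regs c 0 ≤ encode c
  encode-≥ c = ≤-trans (godel-≥ (regs c) (registers>0 P))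
                       (≤-trans (m≤m*n _ width) (m≤m+n _ (label (pc c))))

  -- A halted configuration is fixed by `step`, so `n` may overshoot; the history is cut at the
  -- first halted configuration.
  halting-run : ∀ n c → Halted P (run P n c) → ∃ λ Ms → Run system (encode c ∷ Ms)
  halting-run zero c h = [] , [ encode-final c h ]
  halting-run (suc n) c h = extend (nth P (pc c)) refl (halting-run n (step P c) h)
    where
    extend : ∀ x → nth P (pc c) ≡ x → (∃ λ Ms → Run system (encode (step P c) ∷ Ms)) →
             ∃ λ Ms → Run system (encode c ∷ Ms)
    extend nothing eq _ = [] , [ encode-final c eq ]
    extend (just i) eq (Ms , R) = encode (step P c) ∷ Ms , (encode-step c eq ∷ R)

  run-occurs-closed : ∀ {x} → Closed system x → ∀ n c →
                      Occurs (encode c) x → Occurs (encode (run P n c)) x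
  run-occurs-closed cl zero c o = o
  run-occurs-closed {x} cl (suc n) c o = run-occurs-closed cl n (step P c) (next (nth P (pc c)) refl)
    where
    next : ∀ i → nth P (pc c) ≡ i → Occurs (encode (step P c)) x
    next nothing eq = subst (λ d → Occurs (encode d) x) (sym (step-halted P c eq)) o
    next (just _) eq = cl (encode-step c eq) o

-- Structured programs

data Stmt (n : ℕ) : Set where
  skip : Stmt n
  incr : Fin n → Stmt n
  _⨾_  : Stmt n → Stmt n → Stmt n
  loop : Fin n → Stmt n → Stmt n

infixr 5 _⨾_

data Exec {n : ℕ} : Stmt n → Vec ℕ n → Vec ℕ n → Set where
  skip : ∀ {v} → Exec skip v v
  incr : ∀ {v} r → Exec (incr r) v (v [ r ]≔ suc (lookup v r))
  _⨾_  : ∀ {s t u v w} → Exec s u v → Exec t v w → Exec (s ⨾ t) u w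
  done : ∀ {r s v} → lookup v r ≡ 0 → Exec (loop r s) v v
  more : ∀ {r s u v w k} → lookup u r ≡ suc k → Exec s (u [ r ]≔ k) v →
         Exec (loop r s) v w → Exec (loop r s) u w

size : ∀ {n} → Stmt n → ℕ
size skip = 0
size (incr r) = 1
size (s ⨾ t) = size s + size t
size (loop r s) = suc (size s + 1)

-- A loop tests its register both before and after the body; this makes an
-- unconditional jump unnecessary.
compile : ∀ {n} → ℕ → Stmt n → Program
compile o skip = []
compile o (incr r) = inc (toℕ r) (o + 1) ∷ []
compile o (s ⨾ t) = compile o s ++ compile (o + size s) t
compile o (loop r s) =
  test ∷ compile (suc o) s ++ test ∷ []
  where
  test : Instr
  test = dec (toℕ r) (suc o) (o + size (loop r s))

length-compile : ∀ {n} o (s : Stmt n) → length (compile o s) ≡ size s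
length-compile o skip = refl
length-compile o (incr r) = refl
length-compile o (s ⨾ t) = trans (length-++ (compile o s))
  (cong₂ _+_ (length-compile o s) (length-compile (o + size s) t))
length-compile o (loop r s) = cong suc (trans (length-++ (compile (suc o) s))
  (cong (_+ 1) (length-compile (suc o) s)))

nth-++ˡ : ∀ {A : Set} (xs : List A) {ys q x} → nth xs q ≡ just x → nth (xs ++ ys) q ≡ just x
nth-++ˡ (_ ∷ xs) {q = zero} h = h
nth-++ˡ (_ ∷ xs) {q = suc q} h = nth-++ˡ xs h

nth-++ʳ : ∀ {A : Set} (xs : List A) {ys} q → nth (xs ++ ys) (length xs + q) ≡ nth ys q
nth-++ʳ [] q = refl
nth-++ʳ (_ ∷ xs) q = nth-++ʳ xs q

-- The default 0 lets a vector describe all registers of a machine, so that those outside it are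
-- known to be clean.
get : ∀ {n} → Vec ℕ n → ℕ → ℕ
get [] i = 0
get (x ∷ v) zero = x
get (x ∷ v) (suc i) = get v i

infix 4 _≈_
_≈_ : ∀ {n} → (ℕ → ℕ) → Vec ℕ n → Set
f ≈ v = ∀ i → f i ≡ get v i

get-lookup : ∀ {n} (v : Vec ℕ n) r → get v (toℕ r) ≡ lookup v r
get-lookup (x ∷ v) Fin.zero = refl
get-lookup (x ∷ v) (Fin.suc r) = get-lookup v r

get-update : ∀ {n} (v : Vec ℕ n) r x i → get (v [ r ]≔ x) i ≡ setReg (get v) (toℕ r) x i
get-update (y ∷ v) Fin.zero x zero = refl
get-update (y ∷ v) Fin.zero x (suc i) = refl
get-update (y ∷ v) (Fin.suc r) x zero = refl
get-update (y ∷ v) (Fin.suc r) x (suc i) = get-update v r x i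

setReg-cong : ∀ {f g} r x → (∀ i → f i ≡ g i) → ∀ i → setReg f r x i ≡ setReg g r x i
setReg-cong r x h i with r ≡ᵇ i
... | true = refl
... | false = h i

≈-update : ∀ {n f} (v : Vec ℕ n) r x → f ≈ v → setReg f (toℕ r) x ≈ (v [ r ]≔ x)
≈-update v r x h i = trans (setReg-cong (toℕ r) x h i) (sym (get-update v r x i))

≈-lookup : ∀ {n f} (v : Vec ℕ n) r → f ≈ v → f (toℕ r) ≡ lookup v r
≈-lookup v r h = trans (h (toℕ r)) (get-lookup v r)

run-+ : ∀ P m n c → run P (m + n) c ≡ run P n (run P m c)
run-+ P zero n c = refl
run-+ P (suc m) n c = run-+ P m n (step P c)

module _ (P : Program) where

  Reaches : Config → Config → Set
  Reaches c d = ∃ λ n → run P n c ≡ d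

  reaches-trans : ∀ {b c d} → Reaches b c → Reaches c d → Reaches b d
  reaches-trans {b} (m , refl) (n , refl) = m + n , run-+ P m n b

  Loaded : ℕ → Program → Set
  Loaded o is = ∀ q {i} → nth is q ≡ just i → nth P (o + q) ≡ just i

  nth-cong : ∀ {q q′ x} → q ≡ q′ → nth P q ≡ x → nth P q′ ≡ x
  nth-cong refl h = h

  loaded-head : ∀ o {i is} → Loaded o (i ∷ is) → nth P o ≡ just i
  loaded-head o l = nth-cong (+-identityʳ o) (l 0 refl)

  loaded-tail : ∀ o {i is} → Loaded o (i ∷ is) → Loaded (suc o) is
  loaded-tail o l q h = nth-cong (+-suc o q) (l (suc q) h)

  loaded-++ˡ : ∀ o is {js} → Loaded o (is ++ js) → Loaded o is
  loaded-++ˡ o is l q h = l q (nth-++ˡ is h)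

  loaded-++ʳ : ∀ o is {js} → Loaded o (is ++ js) → Loaded (o + length is) js
  loaded-++ʳ o is l q h =
    nth-cong (sym (+-assoc o (length is) q)) (l (length is + q) (trans (nth-++ʳ is q) h))

  exec-reaches : ∀ {n o f v w} {s : Stmt n} → Exec s v w → Loaded o (compile o s) → f ≈ v →
    ∃ λ g → g ≈ w × Reaches ⟨ o , f ⟩ ⟨ o + size s , g ⟩
  -- The address `q` of the test is arbitrary because the first pass enters at the test before the
  -- body and every later one at the test after it.
  loop-reaches : ∀ {n o f r v w} q {s : Stmt n} → Exec (loop r s) v w →
    Loaded o (compile o (loop r s)) →
    nth P q ≡ just (dec (toℕ r) (suc o) (o + size (loop r s))) → f ≈ v →
    ∃ λ g → g ≈ w × Reaches ⟨ q , f ⟩ ⟨ o + size (loop r s) , g ⟩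

  exec-reaches {o = o} {f} skip l h = f , h , 0 , cong ⟨_, f ⟩ (sym (+-identityʳ o))
  exec-reaches {o = o} {f} {v} (incr r) l h =
    setReg f (toℕ r) (suc (f (toℕ r))) ,
    subst (λ z → setReg f (toℕ r) (suc z) ≈ (v [ r ]≔ suc (lookup v r)))
      (sym (≈-lookup v r h)) (≈-update v r _ h) ,
    1 , step-inc {P} f (loaded-head o l)
  exec-reaches {o = o} {s = s ⨾ t} (x ⨾ y) l h
    with exec-reaches x (loaded-++ˡ o (compile o s) l) h
  ... | g , h′ , re
    with exec-reaches y (subst (λ z → Loaded (o + z) (compile (o + size s) t)) (length-compile o s)
                          (loaded-++ʳ o (compile o s) l)) h′
  ... | g′ , h″ , re′ = g′ , h″ , reaches-trans re
    (subst (λ z → Reaches ⟨ o + size s , g ⟩ ⟨ z , g′ ⟩) (+-assoc o (size s) (size t)) re′)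
  exec-reaches {o = o} x@(done _) l h = loop-reaches o x l (loaded-head o l) h
  exec-reaches {o = o} x@(more _ _ _) l h = loop-reaches o x l (loaded-head o l) h

  loop-reaches {f = f} {r} {v} q (done z) l i h =
    f , h , 1 , step-zero {P} f i (trans (≈-lookup v r h) z)
  loop-reaches {o = o} {f} {r} {v} q {s} (more {k = k} z x y) l i h
    with exec-reaches x (loaded-++ˡ (suc o) (compile (suc o) s) (loaded-tail o l)) (≈-update v r k h)
  ... | g , h′ , re with loop-reaches (suc o + size s) y l again h′
    where
    again : nth P (suc o + size s) ≡ just (dec (toℕ r) (suc o) (o + size (loop r s)))
    again = nth-cong (cong (suc o +_) (length-compile (suc o) s))
      (loaded-head (suc o + length (compile (suc o) s))
        (loaded-++ʳ (suc o) (compile (suc o) s) (loaded-tail o l)))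
  ... | g′ , h″ , re′ = g′ , h″ ,
    reaches-trans (1 , step-suc {P} f i (trans (≈-lookup v r h) z)) (reaches-trans re re′)

-- Computing Gödel numbers of sentences

pattern ⟪_,_,_,_,_⟫ m c a b o = m ∷ c ∷ a ∷ b ∷ o ∷ []

-- The input m, a counter c, the arguments a and b of the pairing function
-- (b doubles as the accumulator) and its output o.
m̂ ĉ â b̂ ô : Fin 5
m̂ = # 0
ĉ = # 1
â = # 2
b̂ = # 3
ô = # 4

cast : ∀ {s : Stmt 5} {u v w} → v ≡ w → Exec s u v → Exec s u w
cast refl x = x


b→a,o : Stmt 5
b→a,o = loop b̂ (incr â ⨾ incr ô)

exec-b→a,o : ∀ {m c} b {a o} → Exec b→a,o ⟪ m , c , a , b , o ⟫ ⟪ m , c , b + a , 0 , b + o ⟫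
exec-b→a,o zero = done refl
exec-b→a,o {m} {c} (suc b) {a} {o} = more refl (incr â ⨾ incr ô)
  (cast (cong₂ ⟪ m , c ,_, 0 ,_⟫ (+-suc b a) (+-suc b o)) (exec-b→a,o b))

a→b,o : Stmt 5
a→b,o = loop â (incr b̂ ⨾ incr ô)

exec-a→b,o : ∀ {m c} a {b o} → Exec a→b,o ⟪ m , c , a , b , o ⟫ ⟪ m , c , 0 , a + b , a + o ⟫
exec-a→b,o zero = done refl
exec-a→b,o {m} {c} (suc a) {b} {o} = more refl (incr b̂ ⨾ incr ô)
  (cast (cong₂ ⟪ m , c , 0 ,_,_⟫ (+-suc a b) (+-suc a o)) (exec-a→b,o a))

b→a : Stmt 5
b→a = loop b̂ (incr â)

exec-b→a : ∀ {m c} b {a o} → Exec b→a ⟪ m , c , a , b , o ⟫ ⟪ m , c , b + a , 0 , o ⟫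
exec-b→a zero = done refl
exec-b→a {m} {c} (suc b) {a} {o} = more refl (incr â)
  (cast (cong ⟪ m , c ,_, 0 , o ⟫ (+-suc b a)) (exec-b→a b))

o→b : Stmt 5
o→b = loop ô (incr b̂)

exec-o→b : ∀ {m c a} o {b} → Exec o→b ⟪ m , c , a , b , o ⟫ ⟪ m , c , a , o + b , 0 ⟫
exec-o→b zero = done refl
exec-o→b {m} {c} {a} (suc o) {b} = more refl (incr b̂)
  (cast (cong ⟪ m , c , a ,_, 0 ⟫ (+-suc o b)) (exec-o→b o))

-- Each pass adds to `ô` the value of `â` before its decrement: one by `incr ô`, the rest by a copy
-- that is restored from `b̂`.
triangle : Stmt 5
triangle = loop â (incr ô ⨾ a→b,o ⨾ b→a)

exec-triangle : ∀ {m c} a {o} → Exec triangle ⟪ m , c , a , 0 , o ⟫ ⟪ m , c , 0 , 0 , tri a + o ⟫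
exec-triangle zero = done refl
exec-triangle {m} {c} (suc a) {o} = more refl
  (incr ô ⨾ exec-a→b,o a ⨾ cast (cong ⟪ m , c ,_, 0 , a + suc o ⟫ (a+0+0 a)) (exec-b→a (a + 0)))
  (cast (cong ⟪ m , c , 0 , 0 ,_⟫ (total a (tri a) o)) (exec-triangle a))
  where
  a+0+0 : ∀ a → a + 0 + 0 ≡ a
  a+0+0 = solve-∀
  total : ∀ a t o → t + (a + suc o) ≡ suc a + t + o
  total = solve-∀

-- After the first loop `â` holds a + b and `ô` holds b, so adding the triangular number of `â` to
-- `ô` completes the Cantor pair.
pairing : Stmt 5
pairing = b→a,o ⨾ triangle ⨾ o→b

exec-pairing : ∀ {m c} a b → Exec pairing ⟪ m , c , a , b , 0 ⟫ ⟪ m , c , 0 , pair a b , 0 ⟫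
exec-pairing {m} {c} a b = exec-b→a,o b ⨾ exec-triangle (b + a) ⨾
  cast (cong ⟪ m , c , 0 ,_, 0 ⟫ pair≡) (exec-o→b (tri (b + a) + (b + 0)))
  where
  pair≡ : tri (b + a) + (b + 0) + 0 ≡ pair a b
  pair≡ = trans (+-identityʳ _) (cong₂ _+_ (cong tri (+-comm b a)) (+-identityʳ b))

add : Fin 5 → ℕ → Stmt 5
add r zero = skip
add r (suc n) = incr r ⨾ add r n

exec-add-a : ∀ {m c} n {a b o} → Exec (add â n) ⟪ m , c , a , b , o ⟫ ⟪ m , c , n + a , b , o ⟫
exec-add-a zero = skip
exec-add-a {m} {c} (suc n) {a} {b} {o} =
  incr â ⨾ cast (cong ⟪ m , c ,_, b , o ⟫ (+-suc n a)) (exec-add-a n)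

exec-add-b : ∀ {m c a} n {b o} → Exec (add b̂ n) ⟪ m , c , a , b , o ⟫ ⟪ m , c , a , n + b , o ⟫
exec-add-b zero = skip
exec-add-b {m} {c} {a} (suc n) {b} {o} =
  incr b̂ ⨾ cast (cong ⟪ m , c , a ,_, o ⟫ (+-suc n b)) (exec-add-b n)

pairLeft : ℕ → Stmt 5
pairLeft k = add â k ⨾ pairing

exec-pairLeft : ∀ {m c} k b → Exec (pairLeft k) ⟪ m , c , 0 , b , 0 ⟫ ⟪ m , c , 0 , pair k b , 0 ⟫
exec-pairLeft {m} {c} k b =
  cast (cong ⟪ m , c ,_, b , 0 ⟫ (+-identityʳ k)) (exec-add-a k) ⨾ exec-pairing k b

pairRight : ℕ → Stmt 5
pairRight k = b→a ⨾ add b̂ k ⨾ pairing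

exec-pairRight : ∀ {m c} k b → Exec (pairRight k) ⟪ m , c , 0 , b , 0 ⟫ ⟪ m , c , 0 , pair b k , 0 ⟫
exec-pairRight {m} {c} k b =
  cast (cong ⟪ m , c ,_, 0 , 0 ⟫ (+-identityʳ b)) (exec-b→a b) ⨾
  cast (cong ⟪ m , c , b ,_, 0 ⟫ (+-identityʳ k)) (exec-add-b k) ⨾ exec-pairing b k

m→c,a : Stmt 5
m→c,a = loop m̂ (incr ĉ ⨾ incr â)

exec-m→c,a : ∀ m {c a b o} → Exec m→c,a ⟪ m , c , a , b , o ⟫ ⟪ 0 , m + c , m + a , b , o ⟫
exec-m→c,a zero = done refl
exec-m→c,a (suc m) {c} {a} {b} {o} = more refl (incr ĉ ⨾ incr â)
  (cast (cong₂ ⟪ 0 ,_,_, b , o ⟫ (+-suc m c) (+-suc m a)) (exec-m→c,a m))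

c→m : Stmt 5
c→m = loop ĉ (incr m̂)

exec-c→m : ∀ {m} c {a b o} → Exec c→m ⟪ m , c , a , b , o ⟫ ⟪ c + m , 0 , a , b , o ⟫
exec-c→m zero = done refl
exec-c→m {m} (suc c) {a} {b} {o} = more refl (incr m̂)
  (cast (cong ⟪_, 0 , a , b , o ⟫ (+-suc c m)) (exec-c→m c))

pairInput : Stmt 5
pairInput = m→c,a ⨾ c→m ⨾ pairing

exec-pairInput : ∀ m b → Exec pairInput ⟪ m , 0 , 0 , b , 0 ⟫ ⟪ m , 0 , 0 , pair m b , 0 ⟫
exec-pairInput m b =
  cast (cong₂ ⟪ 0 ,_,_, b , 0 ⟫ (+-identityʳ m) (+-identityʳ m)) (exec-m→c,a m) ⨾
  cast (cong ⟪_, 0 , m , b , 0 ⟫ (+-identityʳ m)) (exec-c→m m) ⨾ exec-pairing m b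

o→a,b : Stmt 5
o→a,b = loop ô (incr â ⨾ incr b̂)

exec-o→a,b : ∀ {m c} o {a b} → Exec o→a,b ⟪ m , c , a , b , o ⟫ ⟪ m , c , o + a , o + b , 0 ⟫
exec-o→a,b zero = done refl
exec-o→a,b {m} {c} (suc o) {a} {b} = more refl (incr â ⨾ incr b̂)
  (cast (cong₂ ⟪ m , c ,_,_, 0 ⟫ (+-suc o a) (+-suc o b)) (exec-o→a,b o))

b→o : Stmt 5
b→o = loop b̂ (incr ô)

exec-b→o : ∀ {m c a} b {o} → Exec b→o ⟪ m , c , a , b , o ⟫ ⟪ m , c , a , 0 , b + o ⟫
exec-b→o zero = done refl
exec-b→o {m} {c} {a} (suc b) {o} = more refl (incr ô)
  (cast (cong ⟪ m , c , a , 0 ,_⟫ (+-suc b o)) (exec-b→o b))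

-- On the code of t this yields the code of t ∘ₜ t.
double : Stmt 5
double = b→o ⨾ o→a,b ⨾ pairing ⨾ pairLeft 4

exec-double : ∀ {m c} b → Exec double ⟪ m , c , 0 , b , 0 ⟫ ⟪ m , c , 0 , pair 4 (pair b b) , 0 ⟫
exec-double {m} {c} b =
  cast (cong ⟪ m , c , 0 , 0 ,_⟫ (+-identityʳ b)) (exec-b→o b) ⨾
  cast (cong₂ ⟪ m , c ,_,_, 0 ⟫ (+-identityʳ b) (+-identityʳ b)) (exec-o→a,b b) ⨾
  exec-pairing b b ⨾ exec-pairLeft 4 (pair b b)

-- The accumulator form matches the loop `doubleAll`: m passes build the code of a term with 2ᵐ
-- copies of `t`.
doubling : ℕ → Term → Term
doubling zero t = t
doubling (suc m) t = doubling m (t ∘ₜ t)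

doubleAll : Stmt 5
doubleAll = loop m̂ (incr ĉ ⨾ double)

exec-doubleAll : ∀ m {c} t →
  Exec doubleAll ⟪ m , c , 0 , ⌜ t ⌝ₜ , 0 ⟫ ⟪ 0 , m + c , 0 , ⌜ doubling m t ⌝ₜ , 0 ⟫
exec-doubleAll zero t = done refl
exec-doubleAll (suc m) {c} t = more refl (incr ĉ ⨾ exec-double ⌜ t ⌝ₜ)
  (cast (cong ⟪ 0 ,_, 0 , ⌜ doubling m (t ∘ₜ t) ⌝ₜ , 0 ⟫ (+-suc m c)) (exec-doubleAll m (t ∘ₜ t)))

-- A context whose Gödel number is computed by successively pairing the
-- accumulator with constants or with the input.
data Op : Set where
  left right : ℕ → Op
  input : Op

apply : ℕ → List Op → ℕ → ℕ
apply m [] b = b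
apply m (left k ∷ ops) b = apply m ops (pair k b)
apply m (right k ∷ ops) b = apply m ops (pair b k)
apply m (input ∷ ops) b = apply m ops (pair m b)

apply-++ : ∀ m xs {ys} b → apply m (xs ++ ys) b ≡ apply m ys (apply m xs b)
apply-++ m [] b = refl
apply-++ m (left k ∷ xs) b = apply-++ m xs (pair k b)
apply-++ m (right k ∷ xs) b = apply-++ m xs (pair b k)
apply-++ m (input ∷ xs) b = apply-++ m xs (pair m b)

applyOps : List Op → Stmt 5
applyOps [] = skip
applyOps (left k ∷ ops) = pairLeft k ⨾ applyOps ops
applyOps (right k ∷ ops) = pairRight k ⨾ applyOps ops
applyOps (input ∷ ops) = pairInput ⨾ applyOps ops

exec-applyOps : ∀ m ops b →
  Exec (applyOps ops) ⟪ m , 0 , 0 , b , 0 ⟫ ⟪ m , 0 , 0 , apply m ops b , 0 ⟫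
exec-applyOps m [] b = skip
exec-applyOps m (left k ∷ ops) b = exec-pairLeft k b ⨾ exec-applyOps m ops _
exec-applyOps m (right k ∷ ops) b = exec-pairRight k b ⨾ exec-applyOps m ops _
exec-applyOps m (input ∷ ops) b = exec-pairInput m b ⨾ exec-applyOps m ops _

clear-m : Stmt 5
clear-m = loop m̂ skip

exec-clear-m : ∀ m {c a b o} → Exec clear-m ⟪ m , c , a , b , o ⟫ ⟪ 0 , c , a , b , o ⟫
exec-clear-m zero = done refl
exec-clear-m (suc m) = more refl skip (exec-clear-m m)

b→m : Stmt 5
b→m = loop b̂ (incr m̂)

exec-b→m : ∀ {m c a} b {o} → Exec b→m ⟪ m , c , a , b , o ⟫ ⟪ b + m , c , a , 0 , o ⟫
exec-b→m zero = done refl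
exec-b→m {m} {c} {a} (suc b) {o} = more refl (incr m̂)
  (cast (cong ⟪_, c , a , 0 , o ⟫ (+-suc b m)) (exec-b→m b))

-- The input is used twice, as the number of doublings and as the number of the matrix; `doubleAll`
-- consumes it but leaves a copy in `ĉ`.
generator : List Op → Term → Stmt 5
generator ops t = add b̂ ⌜ t ⌝ₜ ⨾ doubleAll ⨾ c→m ⨾ applyOps ops ⨾ clear-m ⨾ b→m

exec-generator : ∀ ops t m →
  Exec (generator ops t) ⟪ m , 0 , 0 , 0 , 0 ⟫ ⟪ apply m ops ⌜ doubling m t ⌝ₜ , 0 , 0 , 0 , 0 ⟫
exec-generator ops t m =
  cast (cong ⟪ m , 0 , 0 ,_, 0 ⟫ (+-identityʳ ⌜ t ⌝ₜ)) (exec-add-b ⌜ t ⌝ₜ) ⨾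
  cast (cong ⟪ 0 ,_, 0 , x , 0 ⟫ (+-identityʳ m)) (exec-doubleAll m t) ⨾
  cast (cong ⟪_, 0 , 0 , x , 0 ⟫ (+-identityʳ m)) (exec-c→m m) ⨾
  exec-applyOps m ops x ⨾ exec-clear-m m ⨾
  cast (cong ⟪_, 0 , 0 , 0 , 0 ⟫ (+-identityʳ (apply m ops x))) (exec-b→m (apply m ops x))
  where
  x = ⌜ doubling m t ⌝ₜ

-- Diagonalisation

-- Clipping the targets at `L` sends every exit to the one address `o + L`, where the subsequent
-- code starts.
relocate : ℕ → ℕ → Instr → Instr
relocate o L (inc r j) = inc r (o + j ⊓ L)
relocate o L (dec r j k) = dec r (o + j ⊓ L) (o + k ⊓ L)

nth-map : ∀ {A B : Set} (f : A → B) xs q {x} → nth xs q ≡ just x → nth (map f xs) q ≡ just (f x)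
nth-map f (_ ∷ xs) zero refl = refl
nth-map f (_ ∷ xs) (suc q) h = nth-map f xs q h

module _ (D P : Program) (o : ℕ) where

  place : ℕ → ℕ
  place q = o + q ⊓ length P

  -- One step is simulated by one step, or by none if `P` has already halted. Registers are compared
  -- pointwise in the absence of function extensionality.
  relocate-step : ∀ {f g} q → Loaded D o (map (relocate o (length P)) P) → (∀ i → g i ≡ f i) →
    ∃ λ g′ → (∀ i → g′ i ≡ regs (step P ⟨ q , f ⟩) i) ×
    Reaches D ⟨ place q , g ⟩ ⟨ place (pc (step P ⟨ q , f ⟩)) , g′ ⟩
  relocate-step {f} {g} q l h = by (nth P q) refl
    where
    fetch : ∀ {i} → nth P q ≡ just i → nth D (place q) ≡ just (relocate o (length P) i)
    fetch {i} eq = subst (λ z → nth D (o + z) ≡ just (relocate o (length P) i))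
      (sym (m≤n⇒m⊓n≡m (<⇒≤ (nth-just⇒< P q eq)))) (l q (nth-map _ P q eq))
    Goal : Config → Set
    Goal c = ∃ λ g′ → (∀ i → g′ i ≡ regs c i) × Reaches D ⟨ place q , g ⟩ ⟨ place (pc c) , g′ ⟩
    by : ∀ x → nth P q ≡ x → Goal (step P ⟨ q , f ⟩)
    by nothing eq = subst Goal (sym (step-halted P ⟨ q , f ⟩ eq)) (g , h , 0 , refl)
    by (just (inc r j)) eq = subst Goal (sym (step-inc {P} f eq))
      (setReg g r (suc (g r)) ,
       (λ i → trans (cong (λ z → setReg g r (suc z) i) (h r)) (setReg-cong r _ h i)) ,
       1 , step-inc {D} g (fetch eq))
    by (just (dec r j k)) eq = onValue (f r) refl
      where
      onValue : ∀ x → f r ≡ x → Goal (step P ⟨ q , f ⟩)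
      onValue zero z = subst Goal (sym (step-zero {P} f eq z))
        (g , h , 1 , step-zero {D} g (fetch eq) (trans (h r) z))
      onValue (suc v) z = subst Goal (sym (step-suc {P} f eq z))
        (setReg g r v , setReg-cong r v h , 1 , step-suc {D} g (fetch eq) (trans (h r) z))

  relocate-run : ∀ t {g} c → Loaded D o (map (relocate o (length P)) P) → (∀ i → g i ≡ regs c i) →
    ∃ λ g′ → (∀ i → g′ i ≡ regs (run P t c) i) ×
    Reaches D ⟨ place (pc c) , g ⟩ ⟨ place (pc (run P t c)) , g′ ⟩
  relocate-run zero {g} c l h = g , h , 0 , refl
  relocate-run (suc t) c l h with relocate-step (pc c) l h
  ... | g′ , h′ , re with relocate-run t (step P c) l h′
  ... | g″ , h″ , re′ = g″ , h″ , reaches-trans D re re′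

-- All registers must agree with a fresh initial state, because the decision program is started
-- right there.
Computes : Program → (ℕ → ℕ) → Set
Computes G h = ∀ D m → Loaded D 0 G →
  ∃ λ g → (∀ i → g i ≡ regs (init (h m)) i) × Reaches D (init m) ⟨ length G , g ⟩

exec-computes : ∀ {s : Stmt 5} {h} →
  (∀ m → Exec s ⟪ m , 0 , 0 , 0 , 0 ⟫ ⟪ h m , 0 , 0 , 0 , 0 ⟫) → Computes (compile 0 s) h
exec-computes {s} x D m l with exec-reaches D (x m) l (single m)
  where
  single : ∀ x → regs (init x) ≈ ⟪ x , 0 , 0 , 0 , 0 ⟫
  single x 0 = refl
  single x 1 = refl
  single x 2 = refl
  single x 3 = refl
  single x 4 = refl
  single x (suc (suc (suc (suc (suc i))))) = refl
... | g , h , re = g , single⁻ h ,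
  subst (λ z → Reaches D (init m) ⟨ z , g ⟩) (sym (length-compile 0 s)) re
  where
  single⁻ : ∀ {x} → g ≈ ⟪ x , 0 , 0 , 0 , 0 ⟫ → ∀ i → g i ≡ regs (init x) i
  single⁻ h 0 = h 0
  single⁻ h 1 = h 1
  single⁻ h 2 = h 2
  single⁻ h 3 = h 3
  single⁻ h 4 = h 4
  single⁻ h (suc (suc (suc (suc (suc i))))) = h (5 + i)

generator-computes : ∀ ops t → ∃ λ G → Computes G (λ m → apply m ops ⌜ doubling m t ⌝ₜ)
generator-computes ops t = compile 0 (generator ops t) , exec-computes (exec-generator ops t)

module _ (P G : Program) where

  private
    mid end : ℕ
    mid = length G
    end = mid + length P

    body verdict : Program
    body = map (relocate mid (length P)) P
    -- Answer 0 jumps to `2 + end`, just past the whole program, and halts; a positive answer enters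
    -- the `inc` at `suc end`, which jumps to itself forever.
    verdict = dec 0 (suc end) (2 + end) ∷ inc 0 (suc end) ∷ []

  diagonal : Program
  diagonal = G ++ body ++ verdict

  private
    loaded : Loaded diagonal 0 diagonal
    loaded q h = h

    loadedʳ : Loaded diagonal mid (body ++ verdict)
    loadedʳ = loaded-++ʳ diagonal 0 G loaded

    loadedP : Loaded diagonal mid body
    loadedP = loaded-++ˡ diagonal mid body loadedʳ

    loadedEnd : Loaded diagonal end verdict
    loadedEnd = subst (λ z → Loaded diagonal (mid + z) verdict) (length-map (relocate mid (length P)) P)
      (loaded-++ʳ diagonal mid body loadedʳ)

    length-diagonal : length diagonal ≡ 2 + end
    length-diagonal = begin
      length diagonal ≡⟨ length-++ G ⟩
      mid + length (body ++ verdict)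
        ≡⟨ cong (mid +_) (length-++ body) ⟩
      mid + (length body + 2)
        ≡⟨ cong (λ z → mid + (z + 2)) (length-map (relocate mid (length P)) P) ⟩
      mid + (length P + 2) ≡⟨ +-assoc mid (length P) 2 ⟨
      end + 2 ≡⟨ +-comm end 2 ⟩
      2 + end ∎
      where open ≡-Reasoning

    nth-length : ∀ {A : Set} (xs : List A) → nth xs (length xs) ≡ nothing
    nth-length [] = refl
    nth-length (_ ∷ xs) = nth-length xs

    answered : ∀ {h} → Computes G h → ∀ m {y} → RunsTo P (h m) y →
      ∃ λ g → g 0 ≡ y × Reaches diagonal (init m) ⟨ end , g ⟩
    answered {h₀} comp m (n , halted , y≡) with comp diagonal m (loaded-++ˡ diagonal 0 G loaded)
    ... | g , h , re with relocate-run diagonal P mid n (init (h₀ m)) loadedP h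
    ... | g′ , h′ , re′ = g′ , trans (h′ 0) y≡ ,
      reaches-trans diagonal re (subst₂ (λ a b → Reaches diagonal ⟨ a , g ⟩ ⟨ b , g′ ⟩)
        (+-identityʳ mid) (cong (mid +_) (m≥n⇒m⊓n≡n (nth-nothing⇒≥ P _ halted))) re′)

  rejected⇒halts : ∀ {h} → Computes G h → ∀ m → RunsTo P (h m) 0 →
    ∃ λ n → Halted diagonal (run diagonal n (init m))
  rejected⇒halts comp m r with answered comp m r
  ... | g , z , re with reaches-trans diagonal re
                          (1 , step-zero {diagonal} g (loaded-head diagonal end loadedEnd) z)
  ... | n , eq = n , subst (Halted diagonal) (sym eq)
    (subst (λ z → nth diagonal z ≡ nothing) length-diagonal (nth-length diagonal))

  accepted⇒grows : ∀ {h} → Computes G h → ∀ m → RunsTo P (h m) 1 → ∀ v →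
    ∃ λ n → v ≤ regs (run diagonal n (init m)) 0
  accepted⇒grows comp m r v with answered comp m r
  ... | g , z , re with reaches-trans diagonal re
          (reaches-trans diagonal (1 , step-suc {diagonal} g (loaded-head diagonal end loadedEnd) z)
            (v , refl))
  ... | n , eq = n , subst (λ c → v ≤ regs c 0) (sym eq) (grow v (setReg g 0 0))
    where
    atInc : nth diagonal (suc end) ≡ just (inc 0 (suc end))
    atInc = loaded-head diagonal (suc end) (loaded-tail diagonal end loadedEnd)
    count : ∀ v f → regs (run diagonal v ⟨ suc end , f ⟩) 0 ≡ v + f 0
    count zero f = refl
    count (suc v) f rewrite step-inc {diagonal} f atInc = trans (count v _) (+-suc v (f 0))
    grow : ∀ v f → v ≤ regs (run diagonal v ⟨ suc end , f ⟩) 0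
    grow v f = subst (v ≤_) (sym (count v f)) (m≤m+n v (f 0))

-- After the answer 1 register 0 would exceed `length x`, while the codes of all configurations
-- reached occur in `x` and bound that register.
closed⇒rejected : ∀ P G {h m x} → Computes G h → Occurs (2 ^ m * 2) x →
  Closed (system (diagonal P G)) x → ¬ RunsTo P (h m) 1
closed⇒rejected P G {h} {m} {x} comp o cl r with accepted⇒grows P G comp m r (suc (length x))
... | n , v≤ = 1+n≰n (≤-trans v≤ (≤-trans (encode-≥ D (run D n (init m)))
    (occurs-≤ (run-occurs-closed D cl n (init m) (cl (start-step D m) o)))))
  where
  D : Program
  D = diagonal P G

rejected⇒run : ∀ P G {h m} → Computes G h → RunsTo P (h m) 0 →
  ∃ λ Ms → Run (system (diagonal P G)) (2 ^ m * 2 ∷ Ms)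
rejected⇒run P G {h} {m} comp r with rejected⇒halts P G comp m r
... | n , halted with halting-run (diagonal P G) n (init m) halted
... | Ms , R = encode (diagonal P G) (init m) ∷ Ms , (start-step (diagonal P G) m ∷ R)

-- From reductions to undecidability

-- The list `ops` does not depend on the system. Hence the generator is fixed first, then the
-- diagonal program, its system and finally the matrix, whose number is supplied only as input; this
-- avoids circularity.
record Reduction (R : Rel) (n m k : ℕ) : Set where
  field
    ops : List Op
    matrix : System → Formula
    sentence : Formula → Term → Formula
    sentence-code : ∀ φ t → ⌜ sentence φ t ⌝ ≡ apply ⌜ φ ⌝ ops ⌜ t ⌝ₜ
    sentence-Σ : ∀ S j → IsΣSentence n m k (sentence (matrix S) (doubling j (c1 ∘ₜ c1)))
    sound : ∀ S j → TrueIn R (sentence (matrix S) (doubling j (c1 ∘ₜ c1))) →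
            ∃ λ x → Occurs (2 ^ j * 2) x × Closed S x
    complete : ∀ S j {Ms} → Run S (2 ^ j * 2 ∷ Ms) →
               TrueIn R (sentence (matrix S) (doubling j (c1 ∘ₜ c1)))

reduction⇒undecidable : ∀ {R n m k} → Reduction R n m k → ¬ DecidableFragment R n m k
reduction⇒undecidable {R} {n} {m} {k} red (P , decides) = contradict (generator-computes ops (c1 ∘ₜ c1))
  where
  open Reduction red
  contradict : (∃ λ G → Computes G (λ d → apply d ops ⌜ doubling d (c1 ∘ₜ c1) ⌝ₜ)) → ⊥
  contradict (G , comp) =
    ¬true (complete S d (proj₂ (rejected⇒run P G comp (answers (proj₂ decided ¬true)))))
    where
    S : System
    S = system (diagonal P G)
    -- The input is the number of the matrix describing the very machine that receives it.
    d : ℕ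
    d = ⌜ matrix S ⌝
    φ : Formula
    φ = sentence (matrix S) (doubling d (c1 ∘ₜ c1))
    decided : (TrueIn R φ → RunsTo P ⌜ φ ⌝ 1) × (¬ TrueIn R φ → RunsTo P ⌜ φ ⌝ 0)
    decided = decides φ (sentence-Σ S d)
    answers : ∀ {y} → RunsTo P ⌜ φ ⌝ y → RunsTo P (apply d ops ⌜ doubling d (c1 ∘ₜ c1) ⌝ₜ) y
    answers {y} = subst (λ z → RunsTo P z y) (sentence-code (matrix S) (doubling d (c1 ∘ₜ c1)))
    ¬true : ¬ TrueIn R φ
    ¬true h = closed⇒rejected P G comp (proj₁ (proj₂ (sound S d h))) (proj₂ (proj₂ (sound S d h)))
                (answers (proj₁ decided h))

-- Formulas, and the structure 𝔅

power : Term → ℕ → Term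
power t zero = e
power t (suc n) = t ∘ₜ power t n

linear : Lin → Term → Term
linear (a , b) t = power t a ∘ₜ power c1 b

power-ones : ∀ {ρ k} t n → ⟦ t ⟧ₜ ρ ≡ ones k → ⟦ power t n ⟧ₜ ρ ≡ ones (n * k)
power-ones t zero h = refl
power-ones {k = k} t (suc n) h = trans (cong₂ _++_ h (power-ones t n h)) (ones-+ k (n * k))

linear-ones : ∀ {ρ k} ℓ t → ⟦ t ⟧ₜ ρ ≡ ones k → ⟦ linear ℓ t ⟧ₜ ρ ≡ ones (ℓ at k)
linear-ones {ρ} {k} (a , b) t h = begin
  ⟦ power t a ⟧ₜ ρ ++ ⟦ power c1 b ⟧ₜ ρ ≡⟨ cong₂ _++_ (power-ones t a h) (power-ones c1 b refl) ⟩
  ones (a * k) ++ ones (b * 1) ≡⟨ ones-+ (a * k) (b * 1) ⟩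
  ones (a * k + b * 1) ≡⟨ cong ones (cong₂ _+_ (*-comm a k) (*-identityʳ b)) ⟩
  ones (k * a + b) ∎
  where open ≡-Reasoning

doubling-ones : ∀ {ρ n} j t → ⟦ t ⟧ₜ ρ ≡ ones n → ⟦ doubling j t ⟧ₜ ρ ≡ ones (2 ^ j * n)
doubling-ones {n = n} zero t h = trans h (cong ones (sym (+-identityʳ n)))
doubling-ones {n = n} (suc j) t h = trans
  (doubling-ones j (t ∘ₜ t) (trans (cong₂ _++_ h h) (ones-+ n n))) (cong ones double≡)
  where
  double≡ : 2 ^ j * (n + n) ≡ 2 * 2 ^ j * n
  double≡ = trans (cong (λ z → 2 ^ j * (n + z)) (sym (+-identityʳ n)))
    (trans (sym (*-assoc (2 ^ j) 2 n)) (cong (_* n) (*-comm (2 ^ j) 2)))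

⋀ ⋁ : {A : Set} → (A → Formula) → List A → Formula
⋀ f [] = e ≐ e
⋀ f (x ∷ xs) = f x ∧ₜ ⋀ f xs
⋁ f [] = ¬≐ e e
⋁ f (x ∷ xs) = f x ∨ₜ ⋁ f xs

module _ {R : Rel} {ρ : Env} {A : Set} (f : A → Formula) where

  ⋀⁺ : ∀ xs → (∀ {x} → x ∈ xs → Sat R ρ (f x)) → Sat R ρ (⋀ f xs)
  ⋀⁺ [] h = refl
  ⋀⁺ (x ∷ xs) h = h (here refl) , ⋀⁺ xs (λ i → h (there i))

  ⋀⁻ : ∀ {xs x} → Sat R ρ (⋀ f xs) → x ∈ xs → Sat R ρ (f x)
  ⋀⁻ (h , _) (here refl) = h
  ⋀⁻ (_ , h) (there i) = ⋀⁻ h i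

  ⋁⁺ : ∀ {xs x} → x ∈ xs → Sat R ρ (f x) → Sat R ρ (⋁ f xs)
  ⋁⁺ (here refl) h = inj₁ h
  ⋁⁺ (there i) h = inj₂ (⋁⁺ i h)

  ⋁⁻ : ∀ xs → Sat R ρ (⋁ f xs) → ∃ λ x → x ∈ xs × Sat R ρ (f x)
  ⋁⁻ [] h = ⊥-elim (h refl)
  ⋁⁻ (x ∷ xs) (inj₁ h) = x , here refl , h
  ⋁⁻ (x ∷ xs) (inj₂ h) with ⋁⁻ xs h
  ... | y , i , h′ = y , there i , h′

-- Variables are numbered from the outermost quantifier inwards, so closedness
-- follows from a bound on the free variables that each quantifier lowers by one.
Below : ℕ → List Var → Set
Below n = All (_< n)

remove-below : ∀ n {xs} → Below (suc n) xs → Below n (remove n xs)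
remove-below n [] = []
remove-below n {x ∷ xs} (h ∷ hs) with n ≡ᵇ x in eq
... | true = remove-below n hs
... | false = ≤∧≢⇒< (≤-pred h) x≢n ∷ remove-below n hs
  where
  x≢n : x ≢ n
  x≢n refl = subst T eq (≡⇒≡ᵇ n n refl)

below-0 : ∀ {xs} → Below 0 xs → xs ≡ []
below-0 [] = refl
below-0 (() ∷ _)

below-power : ∀ {n} t k → Below n (varsT t) → Below n (varsT (power t k))
below-power t zero h = []
below-power t (suc k) h = ++⁺ h (below-power t k h)

below-linear : ∀ {n} ℓ t → Below n (varsT t) → Below n (varsT (linear ℓ t))
below-linear (a , b) t h = ++⁺ (below-power t a h) (below-power c1 b [])

below-doubling : ∀ {n} j t → Below n (varsT t) → Below n (varsT (doubling j t))
below-doubling zero t h = h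
below-doubling (suc j) t h = below-doubling j (t ∘ₜ t) (++⁺ h h)

below-∉ : ∀ {n xs} → Below n xs → ¬ n ∈ᵥ xs
below-∉ (h ∷ _) here = <-irrefl refl h
below-∉ (_ ∷ hs) (there i) = below-∉ hs i

var-below : ∀ i {n} {i<n : True (i <? n)} → Below n (varsT (var i))
var-below i {i<n = i<n} = toWitness i<n ∷ []

-- Well-formedness, closedness and quantifier counts

record Shape (N n m k : ℕ) (φ : Formula) : Set where
  field
    below : Below N (fv φ)
    wf    : WF φ
    count : #∃ᵤ φ ≡ n × #∃⊑ φ ≡ m × #∀⊑ φ ≡ k
open Shape

shape⇒Σ : ∀ {n m k φ} → Shape 0 n m k φ → IsΣSentence n m k φ
shape⇒Σ s = wf s , below-0 (below s) , count s

shape-⊑ : ∀ {N} s t → Below N (varsT s) → Below N (varsT t) → Shape N 0 0 0 (s ⊑ₜ t)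
shape-⊑ s t h h′ = record { below = ++⁺ h h′ ; wf = tt ; count = refl , refl , refl }

shape-¬⊑ : ∀ {N} s t → Below N (varsT s) → Below N (varsT t) → Shape N 0 0 0 (¬⊑ s t)
shape-¬⊑ s t h h′ = record { below = ++⁺ h h′ ; wf = tt ; count = refl , refl , refl }

shape-≐ : ∀ {N} s t → Below N (varsT s) → Below N (varsT t) → Shape N 0 0 0 (s ≐ t)
shape-≐ s t h h′ = record { below = ++⁺ h h′ ; wf = tt ; count = refl , refl , refl }

shape-¬≐ : ∀ {N} s t → Below N (varsT s) → Below N (varsT t) → Shape N 0 0 0 (¬≐ s t)
shape-¬≐ s t h h′ = record { below = ++⁺ h h′ ; wf = tt ; count = refl , refl , refl }

shape-∧ : ∀ {N n m k n′ m′ k′ φ ψ} → Shape N n m k φ → Shape N n′ m′ k′ ψ →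
          Shape N (n + n′) (m + m′) (k + k′) (φ ∧ₜ ψ)
shape-∧ record { below = b ; wf = w ; count = refl , refl , refl }
        record { below = b′ ; wf = w′ ; count = refl , refl , refl } =
  record { below = ++⁺ b b′ ; wf = w , w′ ; count = refl , refl , refl }

shape-∨ : ∀ {N n m k n′ m′ k′ φ ψ} → Shape N n m k φ → Shape N n′ m′ k′ ψ →
          Shape N (n + n′) (m + m′) (k + k′) (φ ∨ₜ ψ)
shape-∨ record { below = b ; wf = w ; count = refl , refl , refl }
        record { below = b′ ; wf = w′ ; count = refl , refl , refl } =
  record { below = ++⁺ b b′ ; wf = w , w′ ; count = refl , refl , refl }

shape-∃ᵤ : ∀ {N n m k φ} → Shape (suc N) n m k φ → Shape N (suc n) m k (∃ᵤ N φ)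
shape-∃ᵤ {N} record { below = b ; wf = w ; count = refl , refl , refl } =
  record { below = remove-below N b ; wf = w ; count = refl , refl , refl }

shape-∃⊑ : ∀ {N n m k φ} t → Below N (varsT t) → Shape (suc N) n m k φ →
           Shape N n (suc m) k (∃⊑ N t φ)
shape-∃⊑ {N} t h record { below = b ; wf = w ; count = refl , refl , refl } =
  record { below = ++⁺ h (remove-below N b) ; wf = below-∉ h , w ; count = refl , refl , refl }

shape-∀⊑ : ∀ {N n m k φ} t → Below N (varsT t) → Shape (suc N) n m k φ →
           Shape N n m (suc k) (∀⊑ N t φ)
shape-∀⊑ {N} t h record { below = b ; wf = w ; count = refl , refl , refl } =
  record { below = ++⁺ h (remove-below N b) ; wf = below-∉ h , w ; count = refl , refl , refl }

shape-⋀ : ∀ {N} {A : Set} (f : A → Formula) xs → (∀ x → Shape N 0 0 0 (f x)) → Shape N 0 0 0 (⋀ f xs)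
shape-⋀ f [] h = shape-≐ e e [] []
shape-⋀ f (x ∷ xs) h = shape-∧ (h x) (shape-⋀ f xs h)

shape-⋁ : ∀ {N} {A : Set} (f : A → Formula) xs → (∀ x → Shape N 0 0 0 (f x)) → Shape N 0 0 0 (⋁ f xs)
shape-⋁ f [] h = shape-¬≐ e e [] []
shape-⋁ f (x ∷ xs) h = shape-∨ (h x) (shape-⋁ f xs h)

-- Sentences asserting a start block

delimit : Term → Term
delimit t = c0 ∘ₜ (t ∘ₜ c0)

-- Read from the inside out: two operations form the code of `t ∘ₜ c0`, two more put `c0` in front;
-- 4 is the tag of `_∘ₜ_`.
delimitOps : List Op
delimitOps = right ⌜ c0 ⌝ₜ ∷ left 4 ∷ left ⌜ c0 ⌝ₜ ∷ left 4 ∷ []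

delimit-code : ∀ m t → ⌜ delimit t ⌝ₜ ≡ apply m delimitOps ⌜ t ⌝ₜ
delimit-code m t = refl

-- The number of such a sentence is assembled in small steps, because unfolding
-- nested pairs during conversion checking duplicates their components.
∃-with : (Term → Formula) → Formula → Term → Formula
∃-with ψ φ t = ∃ᵤ 0 (φ ∧ₜ ψ (delimit t))

-- `input` inserts the number of the matrix, 4 and 8 are the tags of `_∧ₜ_` and `∃ᵤ`, and 0 is the
-- bound variable.
∃∧-code : ∀ φ ψ → ⌜ ∃ᵤ 0 (φ ∧ₜ ψ) ⌝ ≡ apply ⌜ φ ⌝ (input ∷ left 4 ∷ left 0 ∷ left 8 ∷ []) ⌜ ψ ⌝
∃∧-code φ ψ = refl

∃-with-ops : List Op → List Op
∃-with-ops ops = delimitOps ++ (ops ++ input ∷ left 4 ∷ left 0 ∷ left 8 ∷ [])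

∃-with-code : ∀ ψ ops → (∀ m t → ⌜ ψ t ⌝ ≡ apply m ops ⌜ t ⌝ₜ) → ∀ φ t →
  ⌜ ∃-with ψ φ t ⌝ ≡ apply ⌜ φ ⌝ (∃-with-ops ops) ⌜ t ⌝ₜ
∃-with-code ψ ops h φ t = begin
  ⌜ ∃-with ψ φ t ⌝ ≡⟨ ∃∧-code φ (ψ (delimit t)) ⟩
  apply m frame ⌜ ψ (delimit t) ⌝ ≡⟨ cong (apply m frame) (h m (delimit t)) ⟩
  apply m frame (apply m ops ⌜ delimit t ⌝ₜ) ≡⟨ apply-++ m ops ⌜ delimit t ⌝ₜ ⟨
  apply m (ops ++ frame) ⌜ delimit t ⌝ₜ ≡⟨ cong (apply m (ops ++ frame)) (delimit-code m t) ⟩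
  apply m (ops ++ frame) (apply m delimitOps ⌜ t ⌝ₜ) ≡⟨ apply-++ m delimitOps {ops ++ frame} ⌜ t ⌝ₜ ⟨
  apply m (∃-with-ops ops) ⌜ t ⌝ₜ ∎
  where
  open ≡-Reasoning
  m : ℕ
  m = ⌜ φ ⌝
  frame : List Op
  frame = input ∷ left 4 ∷ left 0 ∷ left 8 ∷ []

inVar0 : Term → Formula
inVar0 t = t ⊑ₜ var 0

inVar0Ops : List Op
inVar0Ops = right ⌜ var 0 ⌝ₜ ∷ left 0 ∷ []

startWith : Formula → Term → Formula
startWith = ∃-with inVar0

startWith-code : ∀ φ t → ⌜ startWith φ t ⌝ ≡ apply ⌜ φ ⌝ (∃-with-ops inVar0Ops) ⌜ t ⌝ₜ
startWith-code = ∃-with-code inVar0 inVar0Ops (λ _ _ → refl)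

start : ℕ → Term
start j = doubling j (c1 ∘ₜ c1)

start-ones : ∀ ρ j → ⟦ start j ⟧ₜ ρ ≡ ones (2 ^ j * 2)
start-ones ρ j = doubling-ones j (c1 ∘ₜ c1) refl

below-delimit : ∀ {n} t → Below n (varsT t) → Below n (varsT (delimit t))
below-delimit t h = ++⁺ h []

shape-startWith : ∀ {n m k φ} j → Shape 1 n m k φ →
                  Shape 0 (suc n + 0) (m + 0) (k + 0) (startWith φ (start j))
shape-startWith j s = shape-∃ᵤ (shape-∧ s
  (shape-⊑ (delimit (start j)) (var 0) (below-delimit (start j) (below-doubling j _ [])) (var-below 0)))

-- 𝔅: whenever u = 1ᵏ, each rule enabled at k in x has its effect in x.
closureClause : Lin × Lin → Formula
closureClause (ℓ , r) =
  ¬⊑ (delimit (linear ℓ (var 1))) (var 0) ∨ₜ (delimit (linear r (var 1)) ⊑ₜ var 0)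

-- The disjunct with `c0` exempts the substrings that are not of the form 1ᵏ.
closure : System → Formula
closure S = ∀⊑ 1 (var 0) ((c0 ⊑ₜ var 1) ∨ₜ ⋀ closureClause (rules S))

shape-closure : ∀ S → Shape 1 0 0 1 (closure S)
shape-closure S = shape-∀⊑ (var 0) (var-below 0)
  (shape-∨ (shape-⊑ c0 (var 1) [] (var-below 1)) (shape-⋀ closureClause (rules S) clause))
  where
  clause : ∀ r → Shape 2 0 0 0 (closureClause r)
  clause (ℓ , r) = shape-∨
    (shape-¬⊑ (delimit (linear ℓ (var 1))) (var 0)
      (below-delimit (linear ℓ (var 1)) (below-linear ℓ (var 1) (var-below 1))) (var-below 0))
    (shape-⊑ (delimit (linear r (var 1))) (var 0)
      (below-delimit (linear r (var 1)) (below-linear r (var 1) (var-below 1))) (var-below 0))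

_≟ᵇ_ : (a b : Bit) → Dec (a ≡ b)
𝟎 ≟ᵇ 𝟎 = yes refl
𝟎 ≟ᵇ 𝟏 = no λ ()
𝟏 ≟ᵇ 𝟎 = no λ ()
𝟏 ≟ᵇ 𝟏 = yes refl

-- Completeness in 𝔅 has to choose, for each rule, between absence of the left block and presence of
-- the right one.
substring? : ∀ α β → Dec (SubstringRel α β)
substring? α β = map′ to from (infix? _≟ᵇ_ α β)
  where
  to : Infix.Infix _≡_ α β → SubstringRel α β
  to i with Infix.toView i
  ... | Infix.MkView γ p δ rewrite Pointwise-≡⇒≡ p = γ , δ , refl
  from : SubstringRel α β → Infix.Infix _≡_ α β
  from (γ , δ , refl) = Infix.fromView (Infix.MkView γ (≡⇒Pointwise-≡ refl) δ)

𝟎⊑-or-ones : ∀ u → SubstringRel (𝟎 ∷ []) u ⊎ ∃ λ k → u ≡ ones k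
𝟎⊑-or-ones [] = inj₂ (0 , refl)
𝟎⊑-or-ones (𝟎 ∷ u) = inj₁ ([] , u , refl)
𝟎⊑-or-ones (𝟏 ∷ u) with 𝟎⊑-or-ones u
... | inj₁ (γ , δ , p) = inj₁ (𝟏 ∷ γ , δ , cong (𝟏 ∷_) p)
... | inj₂ (k , p) = inj₂ (suc k , cong (𝟏 ∷_) p)

ones-𝟎-free : ∀ k → ¬ SubstringRel (𝟎 ∷ []) (ones k)
ones-𝟎-free zero ([] , _ , ())
ones-𝟎-free zero (_ ∷ _ , _ , ())
ones-𝟎-free (suc k) (_ ∷ γ , δ , p) = ones-𝟎-free k (γ , δ , ∷-injectiveʳ p)

-- Brings the parameter of an enabled rule into the range of the bounded quantifier of `closure`.
occurs-ones : ∀ {M k x} → k ≤ M → Occurs M x → SubstringRel (ones k) x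
occurs-ones {M} {k} k≤M (γ , δ , p) = γ ++ 𝟎 ∷ [] , ones (M ∸ k) ++ 𝟎 ∷ δ , (begin
  (γ ++ 𝟎 ∷ []) ++ ones k ++ ones (M ∸ k) ++ 𝟎 ∷ δ ≡⟨ ++-assoc γ (𝟎 ∷ []) _ ⟩
  γ ++ 𝟎 ∷ (ones k ++ ones (M ∸ k) ++ 𝟎 ∷ δ)
    ≡⟨ cong (λ z → γ ++ 𝟎 ∷ z) (++-assoc (ones k) (ones (M ∸ k)) _) ⟨
  γ ++ 𝟎 ∷ ((ones k ++ ones (M ∸ k)) ++ 𝟎 ∷ δ)
    ≡⟨ cong (λ z → γ ++ 𝟎 ∷ (z ++ 𝟎 ∷ δ)) (trans (ones-+ k (M ∸ k)) (cong ones (m+[n∸m]≡n k≤M))) ⟩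
  γ ++ 𝟎 ∷ (ones M ++ 𝟎 ∷ δ) ≡⟨ cong (λ z → γ ++ 𝟎 ∷ z) (++-assoc (ones M) (𝟎 ∷ []) δ) ⟨
  γ ++ 𝟎 ∷ ((ones M ++ 𝟎 ∷ []) ++ δ) ≡⟨ p ⟩
  _ ∎)
  where open ≡-Reasoning

delimited : BitString → BitString
delimited w = 𝟎 ∷ w ++ 𝟎 ∷ []

substring-reduction : Reduction SubstringRel 1 0 1
substring-reduction = record
  { ops = ∃-with-ops inVar0Ops
  ; matrix = closure
  ; sentence = startWith
  ; sentence-code = startWith-code
  ; sentence-Σ = λ S j → shape⇒Σ (shape-startWith j (shape-closure S))
  ; sound = sound′
  ; complete = complete′ }
  where
  sound′ : ∀ S j → TrueIn SubstringRel (startWith (closure S) (start j)) →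
           ∃ λ x → Occurs (2 ^ j * 2) x × Closed S x
  sound′ S j (x , h , o) =
    x , subst (λ w → SubstringRel (delimited w) x) (start-ones _ j) o , closed
    where
    closed : Closed S x
    closed st occ with Step.enabled st
    ... | ℓ , r , k , i , k≤ , refl , refl with h (ones k) (occurs-ones k≤ occ)
    ... | inj₁ c = ⊥-elim (ones-𝟎-free k c)
    ... | inj₂ c with ⋀⁻ closureClause c i
    ... | inj₁ ¬o = ⊥-elim (¬o (subst (λ w → SubstringRel (delimited w) x)
                      (sym (linear-ones ℓ (var 1) refl)) occ))
    ... | inj₂ o′ = subst (λ w → SubstringRel (delimited w) x) (linear-ones r (var 1) refl) o′
  complete′ : ∀ S j {Ms} → Run S (2 ^ j * 2 ∷ Ms) → TrueIn SubstringRel (startWith (closure S) (start j))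
  complete′ S j {Ms} R = x , matrix′ ,
    subst (λ w → SubstringRel (delimited w) x) (sym (start-ones _ j)) (run-occurs (2 ^ j * 2) Ms)
    where
    x : BitString
    x = 𝟎 ∷ blocks (2 ^ j * 2 ∷ Ms)
    matrix′ : Sat SubstringRel ((λ _ → []) [ 0 ↦ x ]) (closure S)
    matrix′ u _ with 𝟎⊑-or-ones u
    ... | inj₁ c = inj₁ c
    ... | inj₂ (k , refl) = inj₂ (⋀⁺ closureClause (rules S) clause)
      where
      ρ : Env
      ρ = ((λ _ → []) [ 0 ↦ x ]) [ 1 ↦ ones k ]
      clause : ∀ {r} → r ∈ rules S → Sat SubstringRel ρ (closureClause r)
      clause {ℓ , r} i with substring? (delimited (ones (ℓ at k))) x
      ... | yes o = inj₂ (subst (λ w → SubstringRel (delimited w) x)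
                      (sym (linear-ones {ρ} r (var 1) refl)) (run-closed {k = k} R i o))
      ... | no ¬o = inj₁ (λ o → ¬o (subst (λ w → SubstringRel (delimited w) x)
                      (linear-ones {ρ} ℓ (var 1) refl) o))

-- The structures 𝔇 and 𝔉

-- `c0 ⊑ₜ t` says in 𝔇 only that `t` begins with 𝟎 and in 𝔉 only that `t` is nonempty, so 1* is
-- described by commutation with 𝟏.
isOnes : Term → Formula
isOnes t = (t ∘ₜ c1) ≐ (c1 ∘ₜ t)

shape-isOnes : ∀ {N} t → Below N (varsT t) → Shape N 0 0 0 (isOnes t)
shape-isOnes t h = shape-≐ (t ∘ₜ c1) (c1 ∘ₜ t) (++⁺ h []) h

-- 𝔇: every prefix u 0 of x is x itself or continues with y = 1ᵏ according to a rule.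
ruleAfter : Lin × Lin → Formula
ruleAfter (ℓ , r) =
  (var 1 ∘ₜ (c0 ∘ₜ (linear ℓ (var 2) ∘ₜ delimit (linear r (var 2))))) ⊑ₜ var 0

haltAfter : Lin → Formula
haltAfter ℓ = (var 1 ∘ₜ delimit (linear ℓ (var 2))) ≐ var 0

-- The witness 1ᵏ is in general no prefix of `x`, which starts with 𝟎; this costs the second
-- unbounded quantifier.
prefixes : System → Formula
prefixes S = ∀⊑ 1 (var 0) (∃ᵤ 2
  (¬⊑ (var 1 ∘ₜ c0) (var 0) ∨ₜ (((var 1 ∘ₜ c0) ≐ var 0) ∨ₜ
   (isOnes (var 2) ∧ₜ (haltAfter (halt S) ∨ₜ ⋁ ruleAfter (rules S))))))

shape-prefixes : ∀ S → Shape 1 1 0 1 (prefixes S)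
shape-prefixes S = shape-∀⊑ (var 0) (var-below 0) (shape-∃ᵤ
  (shape-∨ (shape-¬⊑ (var 1 ∘ₜ c0) (var 0) (var-below 1) (var-below 0))
  (shape-∨ (shape-≐ (var 1 ∘ₜ c0) (var 0) (var-below 1) (var-below 0))
  (shape-∧ (shape-isOnes (var 2) (var-below 2))
  (shape-∨
    (shape-≐ (var 1 ∘ₜ delimit (linear (halt S) (var 2))) (var 0)
      (++⁺ (var-below 1) (below-delimit (linear (halt S) (var 2))
        (below-linear (halt S) (var 2) (var-below 2))))
      (var-below 0))
    (shape-⋁ ruleAfter (rules S) rule))))))
  where
  rule : ∀ r → Shape 3 0 0 0 (ruleAfter r)
  rule (ℓ , r) = shape-⊑ _ (var 0)
    (++⁺ (var-below 1) (++⁺ (below-linear ℓ (var 2) (var-below 2))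
      (below-delimit (linear r (var 2)) (below-linear r (var 2) (var-below 2)))))
    (var-below 0)

ruleWord : ℕ → Lin × Lin → BitString → BitString
ruleWord k (ℓ , r) z = ones (ℓ at k) ++ 𝟎 ∷ (ones (r at k) ++ 𝟎 ∷ z)

-- As an equality of types it can be transported along in either direction, for soundness and for
-- completeness.
haltAfter-≡ : ∀ {R} ρ ℓ {k} → ρ 2 ≡ ones k →
  Sat R ρ (haltAfter ℓ) ≡ (ρ 1 ++ 𝟎 ∷ (ones (ℓ at k) ++ 𝟎 ∷ []) ≡ ρ 0)
haltAfter-≡ ρ ℓ h = cong (λ w → ρ 1 ++ 𝟎 ∷ (w ++ 𝟎 ∷ []) ≡ ρ 0) (linear-ones {ρ} ℓ (var 2) h)

ruleAfter-≡ : ∀ ρ ℓ r {k} → ρ 2 ≡ ones k →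
  Sat PrefixRel ρ (ruleAfter (ℓ , r)) ≡
  PrefixRel (ρ 1 ++ 𝟎 ∷ (ones (ℓ at k) ++ 𝟎 ∷ (ones (r at k) ++ 𝟎 ∷ []))) (ρ 0)
ruleAfter-≡ ρ ℓ r h = cong₂ (λ w w′ → PrefixRel (ρ 1 ++ 𝟎 ∷ (w ++ 𝟎 ∷ (w′ ++ 𝟎 ∷ []))) (ρ 0))
  (linear-ones {ρ} ℓ (var 2) h) (linear-ones {ρ} r (var 2) h)

ruleWord-assoc : ∀ u k ℓ r z →
  (u ++ 𝟎 ∷ (ones (ℓ at k) ++ 𝟎 ∷ (ones (r at k) ++ 𝟎 ∷ []))) ++ z ≡ u ++ 𝟎 ∷ ruleWord k (ℓ , r) z
ruleWord-assoc u k ℓ r z = trans (++-assoc u _ z) (cong (λ w → u ++ 𝟎 ∷ w)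
  (trans (++-assoc (ones (ℓ at k)) _ z)
    (cong (λ w → ones (ℓ at k) ++ 𝟎 ∷ w) (++-assoc (ones (r at k)) (𝟎 ∷ []) z))))

cancel-𝟎 : ∀ (u : BitString) {v w} → u ++ 𝟎 ∷ v ≡ u ++ 𝟎 ∷ w → v ≡ w
cancel-𝟎 u h = ∷-injectiveʳ (++-cancelˡ u _ _ h)

-- Settles the prefixes not followed by 𝟎: what follows `u` in `x` is uniquely determined.
¬snoc-𝟎 : ∀ u {γ x} → u ++ γ ≡ x → (∀ v → γ ≢ 𝟎 ∷ v) → ¬ PrefixRel (u ++ 𝟎 ∷ []) x
¬snoc-𝟎 u p γ≢ (δ , q) = γ≢ δ (++-cancelˡ u _ _ (trans p (trans (sym q) (++-assoc u (𝟎 ∷ []) δ))))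

prefix-reduction : Reduction PrefixRel 2 0 1
prefix-reduction = record
  { ops = ∃-with-ops inVar0Ops
  ; matrix = prefixes
  ; sentence = startWith
  ; sentence-code = startWith-code
  ; sentence-Σ = λ S j → shape⇒Σ (shape-startWith j (shape-prefixes S))
  ; sound = sound′
  ; complete = complete′ }
  where
  sound′ : ∀ S j → TrueIn PrefixRel (startWith (prefixes S) (start j)) →
           ∃ λ x → Occurs (2 ^ j * 2) x × Closed S x
  sound′ S j (x , h , (z , p)) =
    x , ([] , z , subst (λ w → delimited w ++ z ≡ x) (start-ones _ j) p) , continues⇒closed continues
    where
    continues : ∀ u v → u ++ 𝟎 ∷ v ≡ x → v ≡ [] ⊎ ∃ λ k → Continues S k v
    continues u v q with h u (𝟎 ∷ v , q)
    ... | y , inj₁ ¬pre = ⊥-elim (¬pre (v , trans (++-assoc u (𝟎 ∷ []) v) q))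
    ... | y , inj₂ (inj₁ eq) = inj₁ (cancel-𝟎 u (trans q (sym eq)))
    ... | y , inj₂ (inj₂ (comm , c)) with comm⇒ones y comm
    ... | k , refl = inj₂ (k , after c)
      where
      ρ : Env
      ρ = (((λ _ → []) [ 0 ↦ x ]) [ 1 ↦ u ]) [ 2 ↦ ones k ]
      after : Sat PrefixRel ρ (haltAfter (halt S) ∨ₜ ⋁ ruleAfter (rules S)) → Continues S k v
      after (inj₁ c) = inj₁ (cancel-𝟎 u (trans q
        (sym (subst (λ A → A) (haltAfter-≡ {PrefixRel} ρ (halt S) refl) c))))
      after (inj₂ c) with ⋁⁻ ruleAfter (rules S) c
      ... | (ℓ , r) , i , c′ with subst (λ A → A) (ruleAfter-≡ ρ ℓ r refl) c′
      ... | z , p = inj₂ (ℓ , r , i , z ,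
        cancel-𝟎 u (trans q (trans (sym p) (ruleWord-assoc u k ℓ r z))))
  complete′ : ∀ S j {Ms} → Run S (2 ^ j * 2 ∷ Ms) → TrueIn PrefixRel (startWith (prefixes S) (start j))
  complete′ S j {Ms} R = x , matrix′ , blocks Ms ,
    subst (λ w → delimited w ++ blocks Ms ≡ x) (sym (start-ones _ j))
      (cong (𝟎 ∷_) (++-assoc (ones (2 ^ j * 2)) (𝟎 ∷ []) (blocks Ms)))
    where
    x : BitString
    x = 𝟎 ∷ blocks (2 ^ j * 2 ∷ Ms)
    matrix′ : Sat PrefixRel ((λ _ → []) [ 0 ↦ x ]) (prefixes S)
    -- No block starts here, so the witness for the inner quantifier is arbitrary.
    matrix′ u ([] , p) = [] , inj₁ (¬snoc-𝟎 u p (λ _ ()))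
    matrix′ u (𝟏 ∷ γ , p) = [] , inj₁ (¬snoc-𝟎 u p (λ _ ()))
    matrix′ u (𝟎 ∷ v , p) with run-continues R u v p
    ... | inj₁ refl = [] , inj₂ (inj₁ p)
    ... | inj₂ (k , _ , c) = ones k , inj₂ (inj₂ (ones-comm k , after c))
      where
      ρ : Env
      ρ = (((λ _ → []) [ 0 ↦ x ]) [ 1 ↦ u ]) [ 2 ↦ ones k ]
      after : Continues S k v → Sat PrefixRel ρ (haltAfter (halt S) ∨ₜ ⋁ ruleAfter (rules S))
      after (inj₁ q) = inj₁ (subst (λ A → A) (sym (haltAfter-≡ {PrefixRel} ρ (halt S) refl))
        (trans (cong (λ w → u ++ 𝟎 ∷ w) (sym q)) p))
      after (inj₂ (ℓ , r , i , z , q)) = inj₂ (⋁⁺ ruleAfter i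
        (subst (λ A → A) (sym (ruleAfter-≡ ρ ℓ r refl))
          (z , trans (ruleWord-assoc u k ℓ r z) (trans (cong (λ w → u ++ 𝟎 ∷ w) (sym q)) p))))

-- 𝔉: the same property, with x split as u 0 v and v as 1ᵃ 0 1ᵇ 0 z by bounded quantifiers.
ruleSplit : Lin × Lin → Formula
ruleSplit (ℓ , r) =
  var 2 ≐ (linear ℓ (var 3) ∘ₜ (c0 ∘ₜ (linear r (var 3) ∘ₜ (c0 ∘ₜ var 4))))

haltSplit : Lin → Formula
haltSplit ℓ = var 2 ≐ (linear ℓ (var 3) ∘ₜ c0)

splits : System → Formula
splits S = ∀⊑ 1 (var 0) (∀⊑ 2 (var 0) (∃⊑ 3 (var 0) (∃⊑ 4 (var 0)
  (¬≐ (var 1 ∘ₜ (c0 ∘ₜ var 2)) (var 0) ∨ₜ ((var 2 ≐ e) ∨ₜ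
   (isOnes (var 3) ∧ₜ (haltSplit (halt S) ∨ₜ ⋁ ruleSplit (rules S))))))))

-- 𝔉 compares only lengths, so being a prefix is expressed by naming the remainder; this is the
-- third bounded existential quantifier.
splitVar0 : Term → Formula
splitVar0 t = ∃⊑ 1 (var 0) (var 0 ≐ (t ∘ₜ var 1))

equalVar0Ops boundVar0Ops : List Op
equalVar0Ops = right ⌜ var 1 ⌝ₜ ∷ left 4 ∷ left ⌜ var 0 ⌝ₜ ∷ left 2 ∷ []
boundVar0Ops = left ⌜ var 0 ⌝ₜ ∷ left 1 ∷ left 6 ∷ []

splitVar0-code : ∀ m t → ⌜ splitVar0 t ⌝ ≡ apply m (equalVar0Ops ++ boundVar0Ops) ⌜ t ⌝ₜ
splitVar0-code m t = begin
  ⌜ splitVar0 t ⌝ ≡⟨ bound-code (var 0 ≐ (t ∘ₜ var 1)) ⟩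
  apply m boundVar0Ops ⌜ var 0 ≐ (t ∘ₜ var 1) ⌝ ≡⟨ cong (apply m boundVar0Ops) (equal-code t) ⟩
  apply m boundVar0Ops (apply m equalVar0Ops ⌜ t ⌝ₜ) ≡⟨ apply-++ m equalVar0Ops {boundVar0Ops} ⌜ t ⌝ₜ ⟨
  apply m (equalVar0Ops ++ boundVar0Ops) ⌜ t ⌝ₜ ∎
  where
  open ≡-Reasoning
  bound-code : ∀ φ → ⌜ ∃⊑ 1 (var 0) φ ⌝ ≡ apply m boundVar0Ops ⌜ φ ⌝
  bound-code φ = refl
  equal-code : ∀ t → ⌜ var 0 ≐ (t ∘ₜ var 1) ⌝ ≡ apply m equalVar0Ops ⌜ t ⌝ₜ
  equal-code t = refl

splitStart : Formula → Term → Formula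
splitStart = ∃-with splitVar0

splitStart-code : ∀ φ t →
  ⌜ splitStart φ t ⌝ ≡ apply ⌜ φ ⌝ (∃-with-ops (equalVar0Ops ++ boundVar0Ops)) ⌜ t ⌝ₜ
splitStart-code = ∃-with-code splitVar0 (equalVar0Ops ++ boundVar0Ops) splitVar0-code

shape-splits : ∀ S → Shape 1 0 2 2 (splits S)
shape-splits S = shape-∀⊑ (var 0) (var-below 0) (shape-∀⊑ (var 0) (var-below 0)
  (shape-∃⊑ (var 0) (var-below 0) (shape-∃⊑ (var 0) (var-below 0)
  (shape-∨ (shape-¬≐ (var 1 ∘ₜ (c0 ∘ₜ var 2)) (var 0) (++⁺ (var-below 1) (var-below 2)) (var-below 0))
  (shape-∨ (shape-≐ (var 2) e (var-below 2) [])
  (shape-∧ (shape-isOnes (var 3) (var-below 3))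
  (shape-∨
    (shape-≐ (var 2) (linear (halt S) (var 3) ∘ₜ c0) (var-below 2)
      (++⁺ (below-linear (halt S) (var 3) (var-below 3)) []))
    (shape-⋁ ruleSplit (rules S) rule))))))))
  where
  rule : ∀ r → Shape 5 0 0 0 (ruleSplit r)
  rule (ℓ , r) = shape-≐ (var 2) _ (var-below 2)
    (++⁺ (below-linear ℓ (var 3) (var-below 3))
      (++⁺ (below-linear r (var 3) (var-below 3)) (var-below 4)))

shape-splitStart : ∀ S j → Shape 0 1 3 2 (splitStart (splits S) (start j))
shape-splitStart S j = shape-∃ᵤ (shape-∧ (shape-splits S) (shape-∃⊑ (var 0) (var-below 0)
  (shape-≐ (var 0) (delimit (start j) ∘ₜ var 1) (var-below 0)
    (++⁺ (below-delimit (start j) (below-doubling j _ [])) (var-below 1)))))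

haltSplit-≡ : ∀ ρ ℓ {k} → ρ 3 ≡ ones k →
  Sat LengthRel ρ (haltSplit ℓ) ≡ (ρ 2 ≡ ones (ℓ at k) ++ 𝟎 ∷ [])
haltSplit-≡ ρ ℓ h = cong (λ w → ρ 2 ≡ w ++ 𝟎 ∷ []) (linear-ones {ρ} ℓ (var 3) h)

ruleSplit-≡ : ∀ ρ ℓ r {k} → ρ 3 ≡ ones k →
  Sat LengthRel ρ (ruleSplit (ℓ , r)) ≡ (ρ 2 ≡ ruleWord k (ℓ , r) (ρ 4))
ruleSplit-≡ ρ ℓ r h = cong₂ (λ w w′ → ρ 2 ≡ w ++ 𝟎 ∷ (w′ ++ 𝟎 ∷ ρ 4))
  (linear-ones {ρ} ℓ (var 3) h) (linear-ones {ρ} r (var 3) h)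

length-after-𝟎 : ∀ (u : BitString) {v} → length v ≤ length (u ++ 𝟎 ∷ v)
length-after-𝟎 u {v} = ≤-trans (n≤1+n (length v)) (length-++-≤ʳ (𝟎 ∷ v) {u})

length-reduction : Reduction LengthRel 1 3 2
length-reduction = record
  { ops = ∃-with-ops (equalVar0Ops ++ boundVar0Ops)
  ; matrix = splits
  ; sentence = splitStart
  ; sentence-code = splitStart-code
  ; sentence-Σ = λ S j → shape⇒Σ (shape-splitStart S j)
  ; sound = sound′
  ; complete = complete′ }
  where
  sound′ : ∀ S j → TrueIn LengthRel (splitStart (splits S) (start j)) →
           ∃ λ x → Occurs (2 ^ j * 2) x × Closed S x
  sound′ S j (x , h , (z , _ , p)) =
    x , ([] , z , subst (λ w → delimited w ++ z ≡ x) (start-ones _ j) (sym p)) ,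
    continues⇒closed continues
    where
    continues : ∀ u v → u ++ 𝟎 ∷ v ≡ x → v ≡ [] ⊎ ∃ λ k → Continues S k v
    continues u v refl with h u (length-++-≤ˡ u)
                              v (length-after-𝟎 u)
    ... | _ , _ , _ , _ , inj₁ ¬eq = ⊥-elim (¬eq refl)
    ... | _ , _ , _ , _ , inj₂ (inj₁ eq) = inj₁ eq
    ... | y , _ , z , _ , inj₂ (inj₂ (comm , c)) with comm⇒ones y comm
    ... | k , refl = inj₂ (k , after c)
      where
      ρ : Env
      ρ = (((((λ _ → []) [ 0 ↦ x ]) [ 1 ↦ u ]) [ 2 ↦ v ]) [ 3 ↦ ones k ]) [ 4 ↦ z ]
      after : Sat LengthRel ρ (haltSplit (halt S) ∨ₜ ⋁ ruleSplit (rules S)) → Continues S k v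
      after (inj₁ c) = inj₁ (subst (λ A → A) (haltSplit-≡ ρ (halt S) refl) c)
      after (inj₂ c) with ⋁⁻ ruleSplit (rules S) c
      ... | (ℓ , r) , i , c′ = inj₂ (ℓ , r , i , z , subst (λ A → A) (ruleSplit-≡ ρ ℓ r refl) c′)
  complete′ : ∀ S j {Ms} → Run S (2 ^ j * 2 ∷ Ms) → TrueIn LengthRel (splitStart (splits S) (start j))
  complete′ S j {Ms} R = x , matrix′ , blocks Ms ,
    ≤-trans (length-after-𝟎 (ones (2 ^ j * 2))) (n≤1+n _) ,
    subst (λ w → x ≡ delimited w ++ blocks Ms) (sym (start-ones _ j))
      (cong (𝟎 ∷_) (sym (++-assoc (ones (2 ^ j * 2)) (𝟎 ∷ []) (blocks Ms))))
    where
    x : BitString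
    x = 𝟎 ∷ blocks (2 ^ j * 2 ∷ Ms)
    matrix′ : Sat LengthRel ((λ _ → []) [ 0 ↦ x ]) (splits S)
    -- The length bounds admit pairs that do not split `x` at a 𝟎. Equality of strings is decidable,
    -- and such pairs satisfy the first disjunct.
    matrix′ u _ v v≤x = witness (≡-dec _≟ᵇ_ (u ++ 𝟎 ∷ v) x)
      where
      ρ : BitString → BitString → Env
      ρ y z = (((((λ _ → []) [ 0 ↦ x ]) [ 1 ↦ u ]) [ 2 ↦ v ]) [ 3 ↦ y ]) [ 4 ↦ z ]
      body : Formula
      body = ¬≐ (var 1 ∘ₜ (c0 ∘ₜ var 2)) (var 0) ∨ₜ ((var 2 ≐ e) ∨ₜ
        (isOnes (var 3) ∧ₜ (haltSplit (halt S) ∨ₜ ⋁ ruleSplit (rules S))))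
      witness : Dec (u ++ 𝟎 ∷ v ≡ x) → ∃ λ y → length y ≤ length x × ∃ λ z → length z ≤ length x ×
                Sat LengthRel (ρ y z) body
      witness (no ¬p) = [] , z≤n , [] , z≤n , inj₁ ¬p
      witness (yes p) with run-continues R u v p
      ... | inj₁ eq = [] , z≤n , [] , z≤n , inj₂ (inj₁ eq)
      ... | inj₂ (k , k≤ , inj₁ q) =
        -- The witness fits its bound because k is at most the length of `v`, which is at most that
        -- of `x`.
        ones k , ≤-trans (≤-reflexive (length-ones k)) (≤-trans k≤ v≤x) , [] , z≤n ,
        inj₂ (inj₂ (ones-comm k ,
          inj₁ (subst (λ A → A) (sym (haltSplit-≡ (ρ (ones k) []) (halt S) refl)) q)))
      ... | inj₂ (k , k≤ , inj₂ (ℓ , r , i , z , q)) =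
        ones k , ≤-trans (≤-reflexive (length-ones k)) (≤-trans k≤ v≤x) , z ,
        ≤-trans (≤-trans (length-after-𝟎 (ones (r at k)))
          (≤-trans (length-after-𝟎 (ones (ℓ at k))) (≤-reflexive (cong length (sym q))))) v≤x ,
        inj₂ (inj₂ (ones-comm k ,
          inj₂ (⋁⁺ ruleSplit i (subst (λ A → A) (sym (ruleSplit-≡ (ρ (ones k) z) ℓ r refl)) q))))

theorem14 : ¬ DecidableFragment PrefixRel 2 0 1
    × ¬ DecidableFragment SubstringRel 1 0 1
    × ¬ DecidableFragment LengthRel 1 3 2
theorem14 = reduction⇒undecidable prefix-reduction
  , reduction⇒undecidable substring-reduction
  , reduction⇒undecidable length-reduction
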